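{- Let $L$ be a transitive permutation group of degree $2k$ with a system of imprimitivity consisting of two blocks $A$ and $B$. Let $L_\omega$ be a point-stabiliser and let $L_{(A)}$ be the pointwise stabiliser of $A$ in $L$. Let $\ell\ge1$ and $m\ge2$ be integers, let $\Gamma=\mathrm C(k,2\ell m,m-1)$ and let $uv$ be an arc of $\Gamma$. Then there exists a group $G\le\mathrm{Aut}(\Gamma)$ such that $(\Gamma,G)$ is locally-$L$ and $|G_{uv}|=|L_{(A)}|^{2m(\ell-1)}|L_\omega|^m$.
   Context: A pair $(\Gamma,G)$ with $G\le\mathrm{Aut}(\Gamma)$ is locally-$L$ if $G$ is transitive on the arcs (ordered pairs of adjacent vertices) of $\Gamma$ and the permutation group induced by the vertex-stabiliser $G_v$ on the neighbourhood $\Gamma(v)$ is permutation isomorphic to $L$. The graphs $\mathrm C(k,r,s)$ (for integers $r\ge3$, $1\le s\le r-1$, $k\ge1$) are defined as follows: $\mathrm C(k,r,1)$ has vertex-set $\mathbb Z_k\times\mathbb Z_r$, with $(u,i)$ adjacent to $(v,j)$ iff $i-j\in\{ -1,1\}$. A path in $\mathrm C(k,r,1)$ is traversing if it contains at most one vertex of $\mathbb Z_k\times\{y\}$ for each $y\in\mathbb Z_r$. For $s\ge2$, $\mathrm C(k,r,s)$ has as vertices the traversing paths of length $s-1$ in $\mathrm C(k,r,1)$, two such paths being adjacent iff their union is a traversing path of length $s$ in $\mathrm C(k,r,1)$. -}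

module Defs where

open import Data.Nat using (ℕ; zero; suc)
open import Data.Fin using (Fin; toℕ)
open import Data.Vec using (Vec; lookup)
open import Data.Product using (Σ; _×_; _,_)
open import Data.Sum using (_⊎_)
open import Data.Bool using (Bool; true; false; not)
open import Function using (id; _∘_)
open import Relation.Binary.PropositionalEquality using (_≡_; _≗_)

record IsPermGroup {X : Set} (G : (X → X) → Set) : Set where
  field
    ext    : ∀ f g → f ≗ g → G f → G g
    has-id : G id
    comp   : ∀ f g → G f → G g → G (f ∘ g)
    inv    : ∀ f → G f → Σ (X → X) λ g → G g × (g ∘ f ≗ id) × (f ∘ g ≗ id)

record HasCard {X : Set} (P : (X → X) → Set) (c : ℕ) : Set where
  field
    elems    : Fin c → (X → X)
    inP      : ∀ i → P (elems i)
    distinct : ∀ i j → elems i ≗ elems j → i ≡ j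
    complete : ∀ f → P f → Σ (Fin c) λ i → f ≗ elems i

Transitive : {X : Set} → ((X → X) → Set) → Set
Transitive {X} G = ∀ (x y : X) → Σ (X → X) λ g → G g × g x ≡ y

Stab : {X : Set} → ((X → X) → Set) → X → (X → X) → Set
Stab G ω g = G g × g ω ≡ ω

record IsTwoBlockSystem {X : Set} (G : (X → X) → Set) (blk : X → Bool) : Set where
  field
    A-nonempty : Σ X λ x → blk x ≡ true
    B-nonempty : Σ X λ x → blk x ≡ false
    invariant  : ∀ g → G g →
                 (∀ x → blk (g x) ≡ blk x) ⊎ (∀ x → blk (g x) ≡ not (blk x))

PointwiseStabA : {X : Set} → ((X → X) → Set) → (X → Bool) → (X → X) → Set
PointwiseStabA {X} G blk g = G g × (∀ (x : X) → blk x ≡ true → g x ≡ x)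

-- The graphs C(k,r,s).
-- A traversing path of length s-1 in C(k,r,1) (with 1 ≤ s ≤ r-1) occupies
-- the layers i, i+1, …, i+s-1 of ℤ_r for a unique i (its first layer in the
-- positive direction), and is determined by i and by the word
-- (x_0,…,x_{s-1}) ∈ ℤ_k^s of its entries, the vertex in layer i+t being
-- (x_t , i+t). We encode it as the pair (i , word).

CVertex : ℕ → ℕ → ℕ → Set
CVertex k r s = Fin r × Vec (Fin k) s

NextLayer : ∀ {r} → Fin r → Fin r → Set
NextLayer {r} i j = (suc (toℕ i) ≡ toℕ j) ⊎ ((suc (toℕ i) ≡ r) × (toℕ j ≡ 0))

-- (i , w) ∪ (j , w') is the traversing path of length s on layers
-- i, …, i+s with entries w_0, …, w_{s-1}, w'_{s-1}:
-- j = i+1 and w'_t = w_{t+1} for t < s-1.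
Extends : ∀ {k r s} → CVertex k r s → CVertex k r s → Set
Extends {s = s} (i , w) (j , w') =
  NextLayer i j × (∀ (t t' : Fin s) → toℕ t' ≡ suc (toℕ t) → lookup w' t ≡ lookup w t')

-- adjacency in C(k,r,s) (for s = 1 this is (x,i) ~ (y,j) iff i - j ∈ {±1})
CAdj : (k r s : ℕ) → CVertex k r s → CVertex k r s → Set
CAdj k r s x y = Extends x y ⊎ Extends y x

IsAutGroup : {X : Set} → (X → X → Set) → ((X → X) → Set) → Set
IsAutGroup {X} Adj G = ∀ g → G g → ∀ (x y : X) →
  ((Adj x y → Adj (g x) (g y)) × (Adj (g x) (g y) → Adj x y))

ArcTransitive : {X : Set} → (X → X → Set) → ((X → X) → Set) → Set
ArcTransitive {X} Adj G = ∀ (u v u' v' : X) → Adj u v → Adj u' v' →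
  Σ (X → X) λ g → G g × g u ≡ u' × g v ≡ v'

record LocalActionIso {X : Set} (Adj : X → X → Set) (G : (X → X) → Set)
                      {d : ℕ} (L : (Fin d → Fin d) → Set) (v : X) : Set where
  field
    nbr        : Fin d → X
    nbr-adj    : ∀ i → Adj v (nbr i)
    nbr-inj    : ∀ i j → nbr i ≡ nbr j → i ≡ j
    nbr-surj   : ∀ w → Adj v w → Σ (Fin d) λ i → nbr i ≡ w
    induced∈L  : ∀ g → G g → g v ≡ v →
                 Σ (Fin d → Fin d) λ h → L h × (∀ i → g (nbr i) ≡ nbr (h i))
    L⊆induced  : ∀ h → L h →
                 Σ (X → X) λ g → G g × g v ≡ v × (∀ i → g (nbr i) ≡ nbr (h i))

LocallyL : {X : Set} → (X → X → Set) → ((X → X) → Set) →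
           {d : ℕ} → ((Fin d → Fin d) → Set) → Set
LocallyL {X} Adj G L = ArcTransitive Adj G × (∀ (v : X) → LocalActionIso Adj G L v)

-- Label the points of layer y by block A or B of L according to the parity of ⌊y / m⌋.  The points
-- adjacent to a vertex (a path on m - 1 layers) lie on two layers at distance m, which carry
-- opposite blocks, so together they form a copy of the domain of L.  Take G to be the group of all
-- dihedral symmetries of the layers combined with bijections between layers such that, on any two
-- layers at distance m, these bijections are jointly induced by an element of L.  Then G is
-- locally-L, and it is arc-transitive because one element of L may be prescribed freely on each
-- residue class of layers mod m.  An element of G fixing an arc fixes every layer and one point in
-- each residue class.  On a class of 2ℓ layers it is given by an element h of the stabiliser of
-- that point, which determines two layers at distance m, and on each of the other 2ℓ - 2 layers
-- by h ∘ μ with μ fixing the opposite block pointwise.  Any choice is allowed: on layers at distance m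
-- the maps h ∘ μ and h ∘ μ′ are both induced by h ∘ μ ∘ μ′.
module Submission where

open import Defs
open import Data.Nat using (ℕ; zero; suc; _+_; _*_; _^_; _∸_; _≤_; _<_; s≤s; z≤n; NonZero)
open import Data.Nat.Properties
  using ( +-assoc; +-comm; +-identityʳ; +-suc; ≤-antisym; ≤-trans; ≤-<-trans; ≤-pred; <⇒≤; m∸n+n≡m
        ; m+[n∸m]≡n; m≤n+m; m≤n⇒m<n∨m≡n; *-cancelˡ-≡ )
open import Data.Nat.DivMod
  using ( _/_; _%_; _mod_; m%n<n; m%n%n≡m%n; %-distribˡ-+; m<n⇒m%n≡m; [m+n]%n≡m%n; n%n≡0; n/n≡1
        ; m≡m%n+[m/n]*n; m∣n⇒o%n%m≡o%m; +-distrib-/-∣ʳ )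
open import Data.Nat.Divisibility using (divides; ∣-refl)
open import Data.Nat.Solver using (module +-*-Solver)
open import Data.Fin
  using ( Fin; zero; suc; toℕ; inject₁; fromℕ; fromℕ<; cast; join; splitAt; combine; remQuot
        ; finToFun; funToFin; opposite )
open import Data.Fin.Relation.Unary.Top using (view; ‵fromℕ; ‵inject₁)
open import Data.Fin.Properties
  using ( toℕ-injective; toℕ<n; toℕ-fromℕ<; toℕ-fromℕ; toℕ-inject₁; toℕ-↑ˡ; toℕ-↑ʳ; toℕ-cast
        ; suc-injective; injective⇒≤; opposite-involutive; opposite-prop; splitAt-join; join-splitAt
        ; remQuot-combine; combine-remQuot; funToFin-finToFin; finToFun-funToFin )
open import Data.Bool using (Bool; true; false; not; _xor_)
open import Data.Bool.Properties
  using ( not-involutive; not-injective; not-distribˡ-xor; not-distribʳ-xor; not-¬; ¬-not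
        ; xor-assoc; xor-comm; xor-same; xor-identityʳ )
  renaming (_≟_ to _≟ᵇ_)
open import Data.Sum using (_⊎_; inj₁; inj₂; map₂)
open import Data.Product using (Σ; _×_; _,_; proj₁; proj₂)
open import Data.Vec using (Vec; []; _∷_; _∷ʳ_; lookup; tabulate; head; tail; replicate)
open import Data.Vec.Properties using (∷ʳ-injectiveʳ; lookup∘tabulate; tabulate∘lookup; tabulate-cong)
open import Function using (id; _∘_; Injective)
open import Relation.Nullary using (¬_; Dec; yes; no; contradiction)
open import Relation.Binary.PropositionalEquality
  using (_≡_; _≢_; _≗_; refl; sym; trans; cong; cong₂; subst; subst₂; module ≡-Reasoning)

-- Arithmetic on the cycle of layers.

module Rotation {r : ℕ} .{{_ : NonZero r}} where

  toℕ-mod : ∀ n → toℕ (n mod r) ≡ n % r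
  toℕ-mod n = toℕ-fromℕ< (m%n<n n r)

  [m%r+n]%r : ∀ m n → (m % r + n) % r ≡ (m + n) % r
  [m%r+n]%r m n = begin
    (m % r + n) % r             ≡⟨ %-distribˡ-+ (m % r) n r ⟩
    (m % r % r + n % r) % r     ≡⟨ cong (λ x → (x + n % r) % r) (m%n%n≡m%n m r) ⟩
    (m % r + n % r) % r         ≡⟨ %-distribˡ-+ m n r ⟨
    (m + n) % r                 ∎
    where open ≡-Reasoning

  infixl 6 _⊕_

  abstract
    -- The shift is an unreduced natural number, so that positions along a path add as numbers and
    -- only the layer is taken modulo `r`.
    _⊕_ : Fin r → ℕ → Fin r
    y ⊕ n = (toℕ y + n) mod r

    toℕ-⊕ : ∀ y n → toℕ (y ⊕ n) ≡ (toℕ y + n) % r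
    toℕ-⊕ y n = toℕ-mod (toℕ y + n)

  ⊕-⊕ : ∀ y a b → y ⊕ a ⊕ b ≡ y ⊕ (a + b)
  ⊕-⊕ y a b = toℕ-injective (begin
    toℕ (y ⊕ a ⊕ b)             ≡⟨ toℕ-⊕ (y ⊕ a) b ⟩
    (toℕ (y ⊕ a) + b) % r       ≡⟨ cong (λ x → (x + b) % r) (toℕ-⊕ y a) ⟩
    ((toℕ y + a) % r + b) % r   ≡⟨ [m%r+n]%r (toℕ y + a) b ⟩
    (toℕ y + a + b) % r         ≡⟨ cong (_% r) (+-assoc (toℕ y) a b) ⟩
    (toℕ y + (a + b)) % r       ≡⟨ toℕ-⊕ y (a + b) ⟨
    toℕ (y ⊕ (a + b))           ∎)
    where open ≡-Reasoning

  ⊕-0 : ∀ y → y ⊕ 0 ≡ y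
  ⊕-0 y = toℕ-injective (begin
    toℕ (y ⊕ 0)       ≡⟨ toℕ-⊕ y 0 ⟩
    (toℕ y + 0) % r   ≡⟨ cong (_% r) (+-identityʳ (toℕ y)) ⟩
    toℕ y % r         ≡⟨ m<n⇒m%n≡m (toℕ<n y) ⟩
    toℕ y             ∎)
    where open ≡-Reasoning

  ⊕-swap : ∀ y a b → y ⊕ a ⊕ b ≡ y ⊕ b ⊕ a
  ⊕-swap y a b = trans (⊕-⊕ y a b) (trans (cong (y ⊕_) (+-comm a b)) (sym (⊕-⊕ y b a)))

  -- The subtraction does not truncate because `toℕ y < r`. The value may reach or exceed `r`; `off`
  -- reduces it.
  diff : Fin r → Fin r → ℕ
  diff y z = toℕ z + (r ∸ toℕ y)

  private
    toℕ+[c+r∸toℕ] : ∀ (y : Fin r) c → toℕ y + (c + (r ∸ toℕ y)) ≡ c + r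
    toℕ+[c+r∸toℕ] y c = begin
      toℕ y + (c + (r ∸ toℕ y))   ≡⟨ +-comm (toℕ y) _ ⟩
      c + (r ∸ toℕ y) + toℕ y     ≡⟨ +-assoc c _ _ ⟩
      c + (r ∸ toℕ y + toℕ y)     ≡⟨ cong (c +_) (m∸n+n≡m (<⇒≤ (toℕ<n y))) ⟩
      c + r                       ∎
      where open ≡-Reasoning

  ⊕-diff : ∀ y z → y ⊕ diff y z ≡ z
  ⊕-diff y z = toℕ-injective (begin
    toℕ (y ⊕ diff y z)                     ≡⟨ toℕ-⊕ y (diff y z) ⟩
    (toℕ y + (toℕ z + (r ∸ toℕ y))) % r    ≡⟨ cong (_% r) (toℕ+[c+r∸toℕ] y (toℕ z)) ⟩
    (toℕ z + r) % r                        ≡⟨ [m+n]%n≡m%n (toℕ z) r ⟩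
    toℕ z % r                              ≡⟨ m<n⇒m%n≡m (toℕ<n z) ⟩
    toℕ z                                  ∎)
    where open ≡-Reasoning

  off : Fin r → Fin r → ℕ
  off j y = diff j y % r

  off-⊕ : ∀ j n → off j (j ⊕ n) ≡ n % r
  off-⊕ j n = begin
    (toℕ (j ⊕ n) + (r ∸ toℕ j)) % r           ≡⟨ cong (λ x → (x + (r ∸ toℕ j)) % r) (toℕ-⊕ j n) ⟩
    ((toℕ j + n) % r + (r ∸ toℕ j)) % r       ≡⟨ [m%r+n]%r (toℕ j + n) (r ∸ toℕ j) ⟩
    (toℕ j + n + (r ∸ toℕ j)) % r             ≡⟨ cong (_% r) (trans (+-assoc (toℕ j) n _) (toℕ+[c+r∸toℕ] j n)) ⟩
    (n + r) % r                               ≡⟨ [m+n]%n≡m%n n r ⟩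
    n % r                                     ∎
    where open ≡-Reasoning

  off<r : ∀ j y → off j y < r
  off<r j y = m%n<n (diff j y) r

  ⊕-% : ∀ j n → j ⊕ (n % r) ≡ j ⊕ n
  ⊕-% j n = toℕ-injective (begin
    toℕ (j ⊕ (n % r))       ≡⟨ toℕ-⊕ j (n % r) ⟩
    (toℕ j + n % r) % r     ≡⟨ cong (_% r) (+-comm (toℕ j) (n % r)) ⟩
    (n % r + toℕ j) % r     ≡⟨ [m%r+n]%r n (toℕ j) ⟩
    (n + toℕ j) % r         ≡⟨ cong (_% r) (+-comm n (toℕ j)) ⟩
    (toℕ j + n) % r         ≡⟨ toℕ-⊕ j n ⟨
    toℕ (j ⊕ n)             ∎)
    where open ≡-Reasoning

  ⊕-off : ∀ j y → j ⊕ off j y ≡ y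
  ⊕-off j y = trans (⊕-% j (diff j y)) (⊕-diff j y)

  -- Shifts commute and `z` is itself a shift of `y`, so the shift `d` that undoes `n` at `y` also
  -- undoes it at `z`.
  ⊕-cancelʳ : ∀ {y z} n → y ⊕ n ≡ z ⊕ n → y ≡ z
  ⊕-cancelʳ {y} {z} n eq = begin
    y                      ≡⟨ back ⟨
    y ⊕ n ⊕ d              ≡⟨ cong (_⊕ d) eq ⟩
    z ⊕ n ⊕ d              ≡⟨ ⊕-⊕ z n d ⟩
    z ⊕ (n + d)            ≡⟨ cong (_⊕ (n + d)) (⊕-diff y z) ⟨
    y ⊕ diff y z ⊕ (n + d) ≡⟨ ⊕-swap y (diff y z) (n + d) ⟩
    y ⊕ (n + d) ⊕ diff y z ≡⟨ cong (_⊕ diff y z) (trans (sym (⊕-⊕ y n d)) back) ⟩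
    y ⊕ diff y z           ≡⟨ ⊕-diff y z ⟩
    z                      ∎
    where
    open ≡-Reasoning
    d = diff (y ⊕ n) y
    back : y ⊕ n ⊕ d ≡ y
    back = ⊕-diff (y ⊕ n) y

  ⊕-fixed : ∀ {y n} → n < r → y ⊕ n ≡ y → n ≡ 0
  ⊕-fixed {y} {n} n<r eq = begin
    n              ≡⟨ m<n⇒m%n≡m n<r ⟨
    n % r          ≡⟨ off-⊕ y n ⟨
    off y (y ⊕ n)  ≡⟨ cong (off y) (trans eq (sym (⊕-0 y))) ⟩
    off y (y ⊕ 0)  ≡⟨ off-⊕ y 0 ⟩
    0 % r          ≡⟨ m<n⇒m%n≡m (≤-<-trans z≤n n<r) ⟩
    0              ∎
    where open ≡-Reasoning

  NextLayer⇒⊕1 : ∀ {i j} → NextLayer i j → j ≡ i ⊕ 1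
  NextLayer⇒⊕1 {i} {j} (inj₁ 1+i≡j) = toℕ-injective (begin
    toℕ j            ≡⟨ m<n⇒m%n≡m (toℕ<n j) ⟨
    toℕ j % r        ≡⟨ cong (_% r) 1+i≡j ⟨
    suc (toℕ i) % r  ≡⟨ cong (_% r) (+-comm 1 (toℕ i)) ⟩
    (toℕ i + 1) % r  ≡⟨ toℕ-⊕ i 1 ⟨
    toℕ (i ⊕ 1)      ∎)
    where open ≡-Reasoning
  NextLayer⇒⊕1 {i} {j} (inj₂ (1+i≡r , j≡0)) = toℕ-injective (begin
    toℕ j            ≡⟨ j≡0 ⟩
    0                ≡⟨ n%n≡0 r ⟨
    r % r            ≡⟨ cong (_% r) (trans (sym 1+i≡r) (+-comm 1 (toℕ i))) ⟩
    (toℕ i + 1) % r  ≡⟨ toℕ-⊕ i 1 ⟨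
    toℕ (i ⊕ 1)      ∎)
    where open ≡-Reasoning

  NextLayer-⊕1 : ∀ i → NextLayer i (i ⊕ 1)
  NextLayer-⊕1 i with m≤n⇒m<n∨m≡n (toℕ<n i)
  ... | inj₁ 1+i<r = inj₁ (sym (trans (toℕ-⊕ i 1) (trans (cong (_% r) (+-comm (toℕ i) 1)) (m<n⇒m%n≡m 1+i<r))))
  ... | inj₂ 1+i≡r = inj₂ (1+i≡r , trans (toℕ-⊕ i 1) (trans (cong (_% r) (trans (+-comm (toℕ i) 1) 1+i≡r)) (n%n≡0 r)))

  -- The law of a rotation (false) or a reflection (true) of the layers.
  Law : Bool → (Fin r → Fin r) → Set
  Law false σ = ∀ y n → σ (y ⊕ n) ≡ σ y ⊕ n
  Law true  σ = ∀ y n → σ (y ⊕ n) ⊕ n ≡ σ y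

  Law-∘ : ∀ a b {σ τ} → Law a σ → Law b τ → Law (a xor b) (σ ∘ τ)
  Law-∘ false false {σ} p q y n = trans (cong σ (q y n)) (p _ n)
  Law-∘ false true  {σ} p q y n = trans (sym (p _ n)) (cong σ (q y n))
  Law-∘ true  false {σ} p q y n = trans (cong (λ z → σ z ⊕ n) (q y n)) (p _ n)
  Law-∘ true  true  {σ} p q y n = trans (sym (p _ n)) (cong (λ z → σ z ⊕ n) (q y n))

  Law-id : Law false id
  Law-id y n = refl

  Law-inverse : ∀ a {σ τ} → (∀ y → σ (τ y) ≡ y) → (∀ y → τ (σ y) ≡ y) → Law a σ → Law a τ
  Law-inverse false {σ} {τ} στ τσ p y n =
    trans (cong τ (trans (cong (_⊕ n) (sym (στ y))) (sym (p (τ y) n)))) (τσ _)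
  Law-inverse true  {σ} {τ} στ τσ p y n =
    trans (sym (τσ _)) (cong τ (⊕-cancelʳ n (trans (p (τ (y ⊕ n)) n) (στ (y ⊕ n)))))

  -- Every layer is a shift of `j`, and a rotation commutes with shifts.
  Law-fixed : ∀ {σ} → Law false σ → ∀ {j} → σ j ≡ j → ∀ y → σ y ≡ y
  Law-fixed {σ} p {j} fix y = begin
    σ y               ≡⟨ cong σ (⊕-diff j y) ⟨
    σ (j ⊕ diff j y)  ≡⟨ p j _ ⟩
    σ j ⊕ diff j y    ≡⟨ cong (_⊕ diff j y) fix ⟩
    j ⊕ diff j y      ≡⟨ ⊕-diff j y ⟩
    y                 ∎
    where open ≡-Reasoning

  -- The rotation or reflection carrying `a` to `b`. In the second case `diff y a` is, modulo `r`,
  -- the negative of the shift from `a` to `y`.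
  turn : Bool → Fin r → Fin r → Fin r → Fin r
  turn false a b y = b ⊕ diff a y
  turn true  a b y = b ⊕ diff y a

  -- Because shifts commute, whether two of them agree does not depend on the base layer. This plays
  -- the part of congruence modulo `r`.
  ⊕-transport : ∀ {y u v} z → y ⊕ u ≡ y ⊕ v → z ⊕ u ≡ z ⊕ v
  ⊕-transport {y} {u} {v} z eq = begin
    z ⊕ u              ≡⟨ cong (_⊕ u) (⊕-diff y z) ⟨
    y ⊕ diff y z ⊕ u   ≡⟨ ⊕-swap y _ u ⟩
    y ⊕ u ⊕ diff y z   ≡⟨ cong (_⊕ diff y z) eq ⟩
    y ⊕ v ⊕ diff y z   ≡⟨ ⊕-swap y v _ ⟩
    y ⊕ diff y z ⊕ v   ≡⟨ cong (_⊕ v) (⊕-diff y z) ⟩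
    z ⊕ v              ∎
    where open ≡-Reasoning

  turn-base : ∀ ε a b → turn ε a b a ≡ b
  turn-base false a b = trans (⊕-transport b (trans (⊕-diff a a) (sym (⊕-0 a)))) (⊕-0 b)
  turn-base true  a b = trans (⊕-transport b (trans (⊕-diff a a) (sym (⊕-0 a)))) (⊕-0 b)

  Law-turn : ∀ ε a b → Law ε (turn ε a b)
  Law-turn false a b y n =
    trans (⊕-transport b (trans (⊕-diff a (y ⊕ n)) (trans (cong (_⊕ n) (sym (⊕-diff a y))) (⊕-⊕ a _ n))))
          (sym (⊕-⊕ b (diff a y) n))
  Law-turn true a b y n =
    trans (⊕-⊕ b _ n) (⊕-transport b
      (trans (sym (⊕-⊕ y _ n)) (trans (⊕-swap y _ n) (trans (⊕-diff (y ⊕ n) a) (sym (⊕-diff y a))))))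

  -- Two maps of the same kind compose to a rotation, and this one fixes `a`.
  turn-inverse : ∀ ε a b y → turn ε b a (turn ε a b y) ≡ y
  turn-inverse ε a b = Law-fixed (involution ε {turn ε b a} {turn ε a b} (Law-turn ε b a) (Law-turn ε a b))
    (trans (cong (turn ε b a) (turn-base ε a b)) (turn-base ε b a))
    where
    involution : ∀ ε {σ τ} → Law ε σ → Law ε τ → Law false (σ ∘ τ)
    involution false = Law-∘ false false
    involution true  = Law-∘ true true

  flip : ∀ {n} → Bool → Fin n → Fin n
  flip false t = t
  flip true  t = opposite t

  flip-xor : ∀ {n} a b (t : Fin n) → flip (a xor b) t ≡ flip a (flip b t)
  flip-xor false b     t = refl
  flip-xor true  false t = refl
  flip-xor true  true  t = sym (opposite-involutive t)

  flip-flip : ∀ {n} a (t : Fin n) → flip a (flip a t) ≡ t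
  flip-flip false t = refl
  flip-flip true  t = opposite-involutive t

  toℕ-opposite-+ : ∀ {n} (t : Fin (suc n)) → toℕ t + toℕ (opposite t) ≡ n
  toℕ-opposite-+ t = trans (cong (toℕ t +_) (opposite-prop t)) (m+[n∸m]≡n (≤-pred (toℕ<n t)))

  -- A reversed path starts at the image of its last layer.
  image-start : Bool → ℕ → (Fin r → Fin r) → Fin r → Fin r
  image-start false n σ i = σ i
  image-start true  n σ i = σ (i ⊕ n)

  -- Under a reflection the image is counted from the image of the last layer; since `t` and
  -- `opposite t` add up to `n`, the image of position `t` stands at `opposite t`.
  image-layer : ∀ ε {n σ} → Law ε σ → ∀ i (t : Fin (suc n)) →
    image-start ε n σ i ⊕ toℕ (flip ε t) ≡ σ (i ⊕ toℕ t)
  image-layer false p i t = sym (p i (toℕ t))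
  image-layer true {n} {σ} p i t = trans
    (cong (λ x → σ x ⊕ toℕ (opposite t))
      (trans (cong (i ⊕_) (sym (toℕ-opposite-+ t))) (sym (⊕-⊕ i (toℕ t) _))))
    (p (i ⊕ toℕ t) _)

-- Sides and residue classes of layers.

odd : ℕ → Bool
odd zero    = false
odd (suc n) = not (odd n)

odd-+ : ∀ m n → odd (m + n) ≡ odd m xor odd n
odd-+ zero    n = refl
odd-+ (suc m) n = trans (cong not (odd-+ m n)) (not-distribˡ-xor (odd m) (odd n))

odd-2* : ∀ n → odd (2 * n) ≡ false
odd-2* zero    = refl
odd-2* (suc n) = trans (cong (not ∘ odd) (+-suc n (n + 0))) (trans (not-involutive _) (odd-2* n))

module Layers (ℓ m : ℕ) .{{_ : NonZero m}} .{{_ : NonZero (2 * ℓ * m)}} where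

  r : ℕ
  r = 2 * ℓ * m

  open Rotation {r} public

  parity : ℕ → Bool
  parity n = odd (n / m)

  parity-+m : ∀ n → parity (n + m) ≡ not (parity n)
  parity-+m n = cong odd (trans (+-distrib-/-∣ʳ n ∣-refl) (trans (cong (n / m +_) (n/n≡1 m)) (+-comm (n / m) 1)))

  parity-+* : ∀ n q → parity (n + q * m) ≡ odd q xor parity n
  parity-+* n zero    = cong parity (+-identityʳ n)
  parity-+* n (suc q) = begin
    parity (n + (m + q * m))   ≡⟨ cong (λ x → parity (n + x)) (+-comm m (q * m)) ⟩
    parity (n + (q * m + m))   ≡⟨ cong parity (+-assoc n (q * m) m) ⟨
    parity (n + q * m + m)     ≡⟨ parity-+m (n + q * m) ⟩
    not (parity (n + q * m))   ≡⟨ cong not (parity-+* n q) ⟩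
    not (odd q xor parity n)   ≡⟨ not-distribˡ-xor (odd q) (parity n) ⟩
    not (odd q) xor parity n   ∎
    where open ≡-Reasoning

  -- One turn around the cycle passes `2 * ℓ` stretches of `m` layers. This number is even, which
  -- makes `side` compatible with reduction modulo `r`.
  parity-+*r : ∀ n q → parity (n + q * r) ≡ parity n
  parity-+*r n zero    = cong parity (+-identityʳ n)
  parity-+*r n (suc q) = begin
    parity (n + (r + q * r))   ≡⟨ cong parity (+-assoc n r (q * r)) ⟨
    parity (n + r + q * r)     ≡⟨ parity-+*r (n + r) q ⟩
    parity (n + 2 * ℓ * m)     ≡⟨ parity-+* n (2 * ℓ) ⟩
    odd (2 * ℓ) xor parity n   ≡⟨ cong (_xor parity n) (odd-2* ℓ) ⟩
    parity n                   ∎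
    where open ≡-Reasoning

  parity-% : ∀ n → parity (n % r) ≡ parity n
  parity-% n = trans (sym (parity-+*r (n % r) (n / r))) (cong parity (sym (m≡m%n+[m/n]*n n r)))

  -- The block of the two-block system that labels the points of a layer.
  side : Fin r → Bool
  side y = parity (toℕ y)

  side-⊕m : ∀ y → side (y ⊕ m) ≡ not (side y)
  side-⊕m y = trans (cong parity (toℕ-⊕ y m)) (trans (parity-% (toℕ y + m)) (parity-+m (toℕ y)))

  -- The residue class modulo `m`, counted from `j` so that position `t` of a path starting at `j`
  -- has class `t`. Reducing modulo `r` first is harmless because `m` divides `r`.
  cls : Fin r → Fin r → Fin m
  cls j y = off j y mod m

  cls-⊕ : ∀ j n → cls j (j ⊕ n) ≡ n mod m
  cls-⊕ j n = toℕ-injective (begin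
    toℕ (cls j (j ⊕ n))   ≡⟨ toℕ-fromℕ< _ ⟩
    off j (j ⊕ n) % m     ≡⟨ cong (_% m) (off-⊕ j n) ⟩
    n % r % m             ≡⟨ m∣n⇒o%n%m≡o%m m r n (divides (2 * ℓ) refl) ⟩
    n % m                 ≡⟨ toℕ-fromℕ< _ ⟨
    toℕ (n mod m)         ∎)
    where open ≡-Reasoning

  mod-toℕ : ∀ (t : Fin m) → toℕ t mod m ≡ t
  mod-toℕ t = toℕ-injective (trans (toℕ-fromℕ< _) (m<n⇒m%n≡m (toℕ<n t)))

  mod-+m : ∀ n → (n + m) mod m ≡ n mod m
  mod-+m n = toℕ-injective (trans (toℕ-fromℕ< _) (trans ([m+n]%n≡m%n n m) (sym (toℕ-fromℕ< _))))

  cls-toℕ : ∀ j (t : Fin m) → cls j (j ⊕ toℕ t) ≡ t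
  cls-toℕ j t = trans (cls-⊕ j (toℕ t)) (mod-toℕ t)

  cls-⊕m : ∀ j y → cls j (y ⊕ m) ≡ cls j y
  cls-⊕m j y = begin
    cls j (y ⊕ m)             ≡⟨ cong (λ x → cls j (x ⊕ m)) (⊕-off j y) ⟨
    cls j (j ⊕ off j y ⊕ m)   ≡⟨ cong (cls j) (⊕-⊕ j (off j y) m) ⟩
    cls j (j ⊕ (off j y + m)) ≡⟨ cls-⊕ j (off j y + m) ⟩
    (off j y + m) mod m       ≡⟨ mod-+m (off j y) ⟩
    cls j y                   ∎
    where open ≡-Reasoning

  -- Write the offset from `j` as `t + q * m` with `t < m`. With `j` the first layer of an edge, a
  -- claim is checked on the layers of that edge and then carried along each residue class.
  layer-induction : ∀ {p} (Q : Fin r → Set p) j → (∀ (t : Fin m) → Q (j ⊕ toℕ t)) →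
                    (∀ y → Q y → Q (y ⊕ m)) → ∀ y → Q y
  layer-induction Q j base step y = subst Q (trans (cong (j ⊕_) (sym n≡)) (⊕-off j y)) (climb (n / m))
    where
    n = off j y
    t = n mod m
    n≡ : n ≡ toℕ t + n / m * m
    n≡ = trans (m≡m%n+[m/n]*n n m) (cong (_+ n / m * m) (sym (toℕ-fromℕ< _)))
    climb : ∀ q → Q (j ⊕ (toℕ t + q * m))
    climb zero    = subst (λ x → Q (j ⊕ x)) (sym (+-identityʳ (toℕ t))) (base t)
    climb (suc q) = subst Q (trans (⊕-⊕ j _ m) (cong (j ⊕_)
      (trans (+-assoc (toℕ t) (q * m) m) (cong (toℕ t +_) (+-comm (q * m) m))))) (step _ (climb q))

-- Fibres of a Boolean function and transport of cardinalities.

record Fiber {n : ℕ} (f : Fin n → Bool) (β : Bool) (c : ℕ) : Set where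
  field
    elem            : Fin c → Fin n
    elem∈           : ∀ x → f (elem x) ≡ β
    elem-injective  : ∀ {x y} → elem x ≡ elem y → x ≡ y
    elem-surjective : ∀ {ω} → f ω ≡ β → Σ (Fin c) λ x → elem x ≡ ω

open Fiber

Fiber-suc : ∀ {n} {f : Fin (suc n) → Bool} {β c} → f zero ≡ not β → Fiber (f ∘ suc) β c → Fiber f β c
Fiber-suc {f = f} {β} f0 F = record
  { elem = suc ∘ elem F ; elem∈ = elem∈ F ; elem-injective = elem-injective F ∘ suc-injective
  ; elem-surjective = surj }
  where
  surj : ∀ {ω} → f ω ≡ β → _
  surj {zero}  e = contradiction (trans (sym e) f0) (not-¬ refl)
  surj {suc ω} e with elem-surjective F e
  ... | x , eq = x , cong suc eq

Fiber-zero : ∀ {n} {f : Fin (suc n) → Bool} {β c} → f zero ≡ β → Fiber (f ∘ suc) β c → Fiber f β (suc c)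
Fiber-zero {n} {f} {β} {c} f0 F = record
  { elem = el ; elem∈ = el∈ ; elem-injective = λ {x} {y} → inj x y ; elem-surjective = surj }
  where
  el : Fin (suc c) → Fin (suc n)
  el zero    = zero
  el (suc x) = suc (elem F x)
  el∈ : ∀ x → f (el x) ≡ β
  el∈ zero    = f0
  el∈ (suc x) = elem∈ F x
  inj : ∀ x y → el x ≡ el y → x ≡ y
  inj zero    zero    e = refl
  inj (suc x) (suc y) e = cong suc (elem-injective F (suc-injective e))
  surj : ∀ {ω} → f ω ≡ β → Σ (Fin (suc c)) λ x → el x ≡ ω
  surj {zero}  e = zero , refl
  surj {suc ω} e with elem-surjective F e
  ... | x , eq = suc x , cong suc eq

fibers : ∀ n (f : Fin n → Bool) → Σ (Bool → ℕ) λ c → c true + c false ≡ n × (∀ β → Fiber f β (c β))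
fibers zero    f = (λ _ → 0) , refl , λ β → record
  { elem = λ () ; elem∈ = λ () ; elem-injective = λ {x} → contradiction x (λ ()) ; elem-surjective = λ { {()} } }
fibers (suc n) f with fibers n (f ∘ suc) | f zero in f0
... | c , c+c≡n , F | true  = (λ { true → suc (c true) ; false → c false }) , cong suc c+c≡n ,
  λ { true → Fiber-zero f0 (F true) ; false → Fiber-suc f0 (F false) }
... | c , c+c≡n , F | false = (λ { true → c true ; false → suc (c false) }) , trans (+-suc _ _) (cong suc c+c≡n) ,
  λ { true → Fiber-suc f0 (F true) ; false → Fiber-zero f0 (F false) }

Fiber-≤ : ∀ {n} {f : Fin n → Bool} {β γ b c} → Fiber f β b → Fiber f γ c → (g : Fin n → Fin n) →
          Injective _≡_ _≡_ g → (∀ {ω} → f ω ≡ β → f (g ω) ≡ γ) → b ≤ c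
Fiber-≤ {b = b} {c} B C g g-inj gβ = injective⇒≤ {f = λ x → proj₁ (im x)} λ {x} {y} e →
  elem-injective B (g-inj (trans (sym (proj₂ (im x))) (trans (cong (elem C) e) (proj₂ (im y)))))
  where
  im : ∀ x → Σ (Fin c) λ y → elem C y ≡ g (elem B x)
  im x = elem-surjective C (gβ (elem∈ B x))

-- Maps are counted up to `≗`, hence the demand that `to` and `from` respect it.
HasCard-transport : ∀ {X : Set} {P Q : (X → X) → Set} {c} (to from : (X → X) → X → X) →
  (∀ {f g} → f ≗ g → to f ≗ to g) → (∀ {f g} → f ≗ g → from f ≗ from g) →
  (∀ f → P f → Q (to f)) → (∀ f → Q f → P (from f)) →
  (∀ f → from (to f) ≗ f) → (∀ f → to (from f) ≗ f) → HasCard P c → HasCard Q c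
HasCard-transport to from to-cong from-cong P⇒Q Q⇒P from-to to-from H = record
  { elems    = to ∘ elems
  ; inP      = λ i → P⇒Q _ (inP i)
  ; distinct = λ i j e → distinct i j λ x →
      trans (sym (from-to (elems i) x)) (trans (from-cong e x) (from-to (elems j) x))
  ; complete = λ f Qf → let i , e = complete (from f) (Q⇒P f Qf) in
      i , λ x → trans (sym (to-from f x)) (to-cong e x)
  }
  where open HasCard H

-- Words, exclusive or, and encoded functions.

lookup-injective : ∀ {A : Set} {n} {v w : Vec A n} → lookup v ≗ lookup w → v ≡ w
lookup-injective {v = v} {w} e = trans (sym (tabulate∘lookup v)) (trans (tabulate-cong e) (tabulate∘lookup w))

lookup-∷ʳ-inject₁ : ∀ {A : Set} {n} (v : Vec A n) x t → lookup (v ∷ʳ x) (inject₁ t) ≡ lookup v t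
lookup-∷ʳ-inject₁ (y ∷ v) x zero    = refl
lookup-∷ʳ-inject₁ (y ∷ v) x (suc t) = lookup-∷ʳ-inject₁ v x t

lookup-∷ʳ-fromℕ : ∀ {A : Set} {n} (v : Vec A n) x → lookup (v ∷ʳ x) (fromℕ n) ≡ x
lookup-∷ʳ-fromℕ []      x = refl
lookup-∷ʳ-fromℕ (y ∷ v) x = lookup-∷ʳ-fromℕ v x

opposite-inject₁ : ∀ {n} (t : Fin n) → opposite (inject₁ t) ≡ suc (opposite t)
-- `opposite (suc x)` computes to `inject₁ (opposite x)`, so with `t` replaced by
-- `opposite (opposite t)` the left side is a double `opposite`.
opposite-inject₁ t = trans (cong (opposite ∘ inject₁) (sym (opposite-involutive t)))
                           (opposite-involutive (suc (opposite t)))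

xor-cancelˡ : ∀ a {b c} → a xor b ≡ a xor c → b ≡ c
xor-cancelˡ false e = e
xor-cancelˡ true  e = not-injective e

xor-cancelʳ : ∀ {a b} c → a xor c ≡ b xor c → a ≡ b
xor-cancelʳ {a} {b} c e = xor-cancelˡ c (trans (xor-comm c a) (trans e (xor-comm b c)))

xor-xor : ∀ a b → (a xor b) xor b ≡ a
xor-xor a b = trans (xor-assoc a b b) (trans (cong (a xor_) (xor-same b)) (xor-identityʳ a))

finToFun-injective : ∀ n o (x y : Fin (n ^ o)) → finToFun {n} {o} x ≗ finToFun y → x ≡ y
finToFun-injective n o x y e = trans (sym (funToFin-finToFin {o} {n} x))
  (trans (funToFin-cong (finToFun x) (finToFun y) e) (funToFin-finToFin {o} {n} y))
  where
  funToFin-cong : ∀ {o} (f g : Fin o → Fin n) → f ≗ g → funToFin f ≡ funToFin g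
  funToFin-cong {zero}  f g e = refl
  funToFin-cong {suc o} f g e = cong₂ combine (e zero) (funToFin-cong (f ∘ suc) (g ∘ suc) (e ∘ suc))

-- Permutation groups with two blocks.

module TwoBlocks {Ω : Set} (L : (Ω → Ω) → Set) (LG : IsPermGroup L)
                 (blk : Ω → Bool) (LB : IsTwoBlockSystem L blk) where

  open IsPermGroup LG public
  open IsTwoBlockSystem LB public

  inverse : ∀ {f} → L f → Ω → Ω
  inverse Lf = proj₁ (inv _ Lf)

  inverse∈L : ∀ {f} (Lf : L f) → L (inverse Lf)
  inverse∈L Lf = proj₁ (proj₂ (inv _ Lf))

  inverseˡ : ∀ {f} (Lf : L f) x → inverse Lf (f x) ≡ x
  inverseˡ Lf = proj₁ (proj₂ (proj₂ (inv _ Lf)))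

  inverseʳ : ∀ {f} (Lf : L f) x → f (inverse Lf x) ≡ x
  inverseʳ Lf = proj₂ (proj₂ (proj₂ (inv _ Lf)))

  L-injective : ∀ {f} → L f → ∀ {x y} → f x ≡ f y → x ≡ y
  L-injective Lf {x} {y} e = trans (sym (inverseˡ Lf x)) (trans (cong (inverse Lf) e) (inverseˡ Lf y))

  inhabited : ∀ β → Σ Ω λ x → blk x ≡ β
  inhabited true  = A-nonempty
  inhabited false = B-nonempty

  same-block : ∀ {f} → L f → ∀ {x y} → blk x ≡ blk y → blk (f x) ≡ blk (f y)
  same-block Lf {x} {y} e with invariant _ Lf
  ... | inj₁ keep = trans (keep x) (trans e (sym (keep y)))
  ... | inj₂ swap = trans (swap x) (trans (cong not e) (sym (swap y)))

  other-block : ∀ {f} → L f → ∀ {x y} → blk x ≡ not (blk y) → blk (f x) ≡ not (blk (f y))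
  other-block Lf {x} {y} e with invariant _ Lf
  ... | inj₁ keep = trans (keep x) (trans e (cong not (sym (keep y))))
  ... | inj₂ swap = trans (swap x) (cong not (trans e (sym (swap y))))

  HasCard-conjugate : ∀ {P Q c g} (Lg : L g) → (∀ f → P f → Q (g ∘ f ∘ inverse Lg)) →
    (∀ f → Q f → P (inverse Lg ∘ f ∘ g)) → HasCard P c → HasCard Q c
  HasCard-conjugate {g = g} Lg P⇒Q Q⇒P = HasCard-transport
    (λ f → g ∘ f ∘ inverse Lg) (λ f → inverse Lg ∘ f ∘ g)
    (λ e x → cong g (e _)) (λ e x → cong (inverse Lg) (e _)) P⇒Q Q⇒P
    (λ f x → trans (inverseˡ Lg _) (cong f (inverseˡ Lg x)))
    (λ f x → trans (inverseʳ Lg _) (cong f (inverseʳ Lg x)))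

  Fix : Bool → (Ω → Ω) → Set
  Fix β f = L f × (∀ x → blk x ≡ β → f x ≡ x)

  Fix-id : ∀ β → Fix β id
  Fix-id β = has-id , λ _ _ → refl

  -- The block `β` is nonempty, and a single fixed point already prevents `f` from exchanging the
  -- blocks.
  Fix-preserves : ∀ {β f} → Fix β f → ∀ x → blk (f x) ≡ blk x
  Fix-preserves {β} (Lf , fix) x with inhabited β | blk x ≟ᵇ β
  ... | _ | yes e = cong blk (fix x e)
  ... | z , ez | no ne = trans (other-block Lf x≡¬z) (trans (cong (not ∘ blk) (fix z ez)) (sym x≡¬z))
    where
    x≡¬z : blk x ≡ not (blk z)
    x≡¬z = trans (¬-not ne) (cong not (sym ez))

  module _ (L-trans : Transitive L) where

    -- By transitivity some element takes a point of one block to a point of the other; it cannot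
    -- keep the blocks.
    swap : Σ (Ω → Ω) λ g → L g × (∀ x → blk (g x) ≡ not (blk x))
    swap with L-trans (proj₁ A-nonempty) (proj₁ B-nonempty)
    ... | g , Lg , e with invariant g Lg
    ... | inj₂ swaps = g , Lg , swaps
    ... | inj₁ keeps = contradiction
      (trans (sym (proj₂ A-nonempty)) (trans (sym (keeps _)) (trans (cong blk e) (proj₂ B-nonempty)))) λ ()

    -- Conjugation by a block-swapping element exchanges the two pointwise stabilisers. Both occur,
    -- since layers of either side carry twists.
    HasCard-Fix : ∀ {a} → HasCard (Fix true) a → ∀ β → HasCard (Fix β) a
    HasCard-Fix A true  = A
    HasCard-Fix A false with swap
    ... | g , Lg , swaps = HasCard-conjugate Lg
      (λ f (Lf , fix) → comp _ _ Lg (comp _ _ Lf (inverse∈L Lg)) , λ x e →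
        trans (cong g (fix _ (not-injective (trans (sym (swaps _)) (trans (cong blk (inverseʳ Lg x)) e)))))
              (inverseʳ Lg x))
      (λ f (Lf , fix) → comp _ _ (inverse∈L Lg) (comp _ _ Lf Lg) , λ x e →
        trans (cong (inverse Lg) (fix _ (trans (swaps x) (cong not e)))) (inverseˡ Lg x))
      A

    -- Conjugation by an element taking `x` to `y`. The points of an edge give stabilisers of
    -- various points of `L`.
    HasCard-Stab : ∀ {b x} → HasCard (Stab L x) b → ∀ y → HasCard (Stab L y) b
    HasCard-Stab {x = x} B y with L-trans x y
    ... | g , Lg , refl = HasCard-conjugate Lg
      (λ f (Lf , fix) → comp _ _ Lg (comp _ _ Lf (inverse∈L Lg)) , cong g (trans (cong f (inverseˡ Lg x)) fix))
      (λ f (Lf , fix) → comp _ _ (inverse∈L Lg) (comp _ _ Lf Lg) , trans (cong (inverse Lg) fix) (inverseˡ Lg x))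
      B

-- This lets a vertex of `C(k,r,1)` on layer `y` stand for a point of the block `side y`.
record Coordinates {n : ℕ} (blk : Fin n → Bool) (k : ℕ) : Set where
  field
    φ     : Bool → Fin k → Fin n
    ψ     : Fin n → Fin k
    blk-φ : ∀ β x → blk (φ β x) ≡ β
    φ-ψ   : ∀ ω → φ (blk ω) (ψ ω) ≡ ω
    ψ-φ   : ∀ β x → ψ (φ β x) ≡ x

-- A block-swapping element injects each block into the other, so both have the same size, which is
-- half of `2 * k`.
coordinates : ∀ k (L : (Fin (2 * k) → Fin (2 * k)) → Set) → IsPermGroup L → Transitive L →
  (blk : Fin (2 * k) → Bool) → IsTwoBlockSystem L blk → Coordinates blk k
coordinates k L LG L-trans blk LB with fibers (2 * k) blk | TwoBlocks.swap L LG blk LB L-trans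
... | c , c+c≡2k , F | g , Lg , swaps = record
  { φ = φ ; ψ = λ ω → proj₁ (pre ω) ; blk-φ = λ β → elem∈ (F′ β) ; φ-ψ = λ ω → proj₂ (pre ω)
  ; ψ-φ = λ β x → elem-injective (F′ β)
      (subst (λ β′ → φ β′ (proj₁ (pre (φ β x))) ≡ φ β x) (elem∈ (F′ β) x) (proj₂ (pre (φ β x)))) }
  where
  open TwoBlocks L LG blk LB using (L-injective)
  ct≡cf : c true ≡ c false
  ct≡cf = ≤-antisym (Fiber-≤ (F true) (F false) g (L-injective Lg) (λ e → trans (swaps _) (cong not e)))
                    (Fiber-≤ (F false) (F true) g (L-injective Lg) (λ e → trans (swaps _) (cong not e)))
  cf≡k : c false ≡ k
  cf≡k = *-cancelˡ-≡ _ _ 2 (trans (cong (c false +_) (+-identityʳ _)) (trans (cong (_+ c false) (sym ct≡cf)) c+c≡2k))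
  c≡k : ∀ β → c β ≡ k
  c≡k true  = trans ct≡cf cf≡k
  c≡k false = cf≡k
  F′ : ∀ β → Fiber blk β k
  F′ β = subst (Fiber blk β) (c≡k β) (F β)
  φ : Bool → Fin k → Fin (2 * k)
  φ β = elem (F′ β)
  pre : ∀ ω → Σ (Fin k) λ x → φ (blk ω) x ≡ ω
  pre ω = elem-surjective (F′ (blk ω)) refl

-- Motions of the layers and the group `G`.

module Construction
  (k : ℕ) {d : ℕ} (L : (Fin d → Fin d) → Set) (LG : IsPermGroup L)
  (blk : Fin d → Bool) (LB : IsTwoBlockSystem L blk)
  (φ : Bool → Fin k → Fin d) (ψ : Fin d → Fin k) (blk-φ : ∀ β x → blk (φ β x) ≡ β)
  (φ-ψ : ∀ ω → φ (blk ω) (ψ ω) ≡ ω) (ψ-φ : ∀ β x → ψ (φ β x) ≡ x)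
  (ℓ s′ : ℕ) {{r≢0 : NonZero (2 * ℓ * suc (suc s′))}} (2<r : 2 < 2 * ℓ * suc (suc s′)) where

  Ω : Set
  Ω = Fin d

  s m : ℕ
  s = suc s′
  m = suc s

  open TwoBlocks L LG blk LB public
  open Layers ℓ m public

  Z : Set
  Z = Fin r

  Path : ℕ → Set
  Path n = Z × Vec (Fin k) n

  Point : Set
  Point = Z × Fin k

  coord : Point → Ω
  coord (y , x) = φ (side y) x

  blk-coord : ∀ P → blk (coord P) ≡ side (proj₁ P)
  blk-coord (y , x) = blk-φ (side y) x

  φ-ψ′ : ∀ {β ω} → blk ω ≡ β → φ β (ψ ω) ≡ ω
  φ-ψ′ {ω = ω} refl = φ-ψ ω

  point-ext : ∀ {P Q : Point} → proj₁ P ≡ proj₁ Q → coord P ≡ coord Q → P ≡ Q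
  point-ext {y , x} {.y , x′} refl e =
    cong (y ,_) (trans (sym (ψ-φ (side y) x)) (trans (cong ψ e) (ψ-φ (side y) x′)))

  at : ∀ {n} → Path n → Fin n → Point
  at (i , w) t = i ⊕ toℕ t , lookup w t

  at-injective : ∀ {n} {u v : Path (suc n)} → at u ≗ at v → u ≡ v
  at-injective {u = i , w} {j , w′} e = cong₂ _,_
    (trans (sym (⊕-0 i)) (trans (cong proj₁ (e zero)) (⊕-0 j)))
    (lookup-injective (cong proj₂ ∘ e))

  record Glued (h : Z → Ω → Ω) (y z : Z) : Set where
    field
      glue   : Ω → Ω
      glue∈L : L glue
      glueˡ  : ∀ {x} → blk x ≡ side y → glue x ≡ h y x
      glueʳ  : ∀ {x} → blk x ≡ side z → glue x ≡ h z x

  open Glued public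

  Glued-sym : ∀ {h y z} → Glued h y z → Glued h z y
  Glued-sym g = record { glue = glue g ; glue∈L = glue∈L g ; glueˡ = glueʳ g ; glueʳ = glueˡ g }

  -- The label h y ∈ L acts on layer y only through its restriction to the block side y.
  record Motion : Set where
    field
      rev        : Bool
      σ σ⁻¹      : Z → Z
      σ-σ⁻¹      : ∀ y → σ (σ⁻¹ y) ≡ y
      σ⁻¹-σ      : ∀ y → σ⁻¹ (σ y) ≡ y
      law        : Law rev σ
      h          : Z → Ω → Ω
      h∈L        : ∀ y → L (h y)
      h-side     : ∀ y {x} → blk x ≡ side y → blk (h y x) ≡ side (σ y)
      glued      : ∀ y → Glued h y (y ⊕ m)

    -- A reflection turns two layers at distance `m` into such a pair in the opposite order, whence
    -- `Glued-sym`.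
    glued-image : ∀ ε {τ} → Law ε τ → ∀ y → Glued h (τ y) (τ (y ⊕ m))
    glued-image false {τ} p y = subst (Glued h (τ y)) (sym (p y m)) (glued (τ y))
    glued-image true  {τ} p y = Glued-sym (subst (Glued h (τ (y ⊕ m))) (p y m) (glued (τ (y ⊕ m))))

    onPoint : Point → Point
    onPoint (y , x) = σ y , ψ (h y (φ (side y) x))

    coord-onPoint : ∀ P → coord (onPoint P) ≡ h (proj₁ P) (coord P)
    coord-onPoint (y , x) = φ-ψ′ (h-side y (blk-φ (side y) x))

    onPoint≡ : ∀ {P Q} → σ (proj₁ P) ≡ proj₁ Q → h (proj₁ P) (coord P) ≡ coord Q → onPoint P ≡ Q
    onPoint≡ {P} e e′ = point-ext e (trans (coord-onPoint P) e′)

    -- The image is again listed from its first layer onward, so a reflection also reverses the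
    -- word.
    act : ∀ {n} → Path (suc n) → Path (suc n)
    act {n} (i , w) = image-start rev n σ i , tabulate λ t → proj₂ (onPoint (at (i , w) (flip rev t)))

    at-act : ∀ {n} (v : Path (suc n)) t → at (act v) (flip rev t) ≡ onPoint (at v t)
    at-act (i , w) t = cong₂ _,_ (image-layer rev law i t)
      (trans (lookup∘tabulate (λ t′ → proj₂ (onPoint (at (i , w) (flip rev t′)))) (flip rev t))
             (cong (proj₂ ∘ onPoint ∘ at (i , w)) (flip-flip rev t)))

    -- A path is determined by its points, so equations between paths reduce to equations between
    -- points; the laws of the action below are obtained in this way.
    act-unique : ∀ {n} (u v : Path (suc n)) → (∀ t → onPoint (at u t) ≡ at v (flip rev t)) → act u ≡ v
    act-unique u v e = at-injective λ t →
      trans (cong (at (act u)) (sym (flip-flip rev t)))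
      (trans (at-act u _) (trans (e _) (cong (at v) (flip-flip rev t))))

  open Motion public

  identity : Motion
  identity = record
    { rev = false ; σ = id ; σ⁻¹ = id ; σ-σ⁻¹ = λ _ → refl ; σ⁻¹-σ = λ _ → refl ; law = Law-id
    ; h = λ _ → id ; h∈L = λ _ → has-id ; h-side = λ _ e → e
    ; glued = λ _ → record { glue = id ; glue∈L = has-id ; glueˡ = λ _ → refl ; glueʳ = λ _ → refl } }

  compose : Motion → Motion → Motion
  compose M N = record
    { rev = rev M xor rev N ; σ = σ M ∘ σ N ; σ⁻¹ = σ⁻¹ N ∘ σ⁻¹ M
    ; σ-σ⁻¹ = λ y → trans (cong (σ M) (σ-σ⁻¹ N _)) (σ-σ⁻¹ M y)
    ; σ⁻¹-σ = λ y → trans (cong (σ⁻¹ N) (σ⁻¹-σ M _)) (σ⁻¹-σ N y)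
    ; law = Law-∘ (rev M) (rev N) (law M) (law N)
    ; h = λ y → h M (σ N y) ∘ h N y
    ; h∈L = λ y → comp _ _ (h∈L M (σ N y)) (h∈L N y)
    ; h-side = λ y e → h-side M (σ N y) (h-side N y e)
    -- `N` moves the pair `y`, `y ⊕ m` first, so the glue of `M` is taken at the two images.
    ; glued = λ y → let g = glued-image M (rev N) (law N) y ; g′ = glued N y in record
        { glue   = glue g ∘ glue g′
        ; glue∈L = comp _ _ (glue∈L g) (glue∈L g′)
        ; glueˡ  = λ e → trans (cong (glue g) (glueˡ g′ e)) (glueˡ g (h-side N y e))
        ; glueʳ  = λ e → trans (cong (glue g) (glueʳ g′ e)) (glueʳ g (h-side N (y ⊕ m) e)) } }

  invert : Motion → Motion
  invert M = record
    { rev = rev M ; σ = σ⁻¹ M ; σ⁻¹ = σ M ; σ-σ⁻¹ = σ⁻¹-σ M ; σ⁻¹-σ = σ-σ⁻¹ M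
    ; law = law⁻¹ ; h = h⁻¹ ; h∈L = λ y → inverse∈L (h∈L M _) ; h-side = h⁻¹-side
    ; glued = λ y → let g = glued-image M (rev M) law⁻¹ y in record
        { glue   = inverse (glue∈L g)
        ; glue∈L = inverse∈L (glue∈L g)
        ; glueˡ  = λ e → solve-glue g (glueˡ g (h⁻¹-side y e)) (inverseʳ (h∈L M _) _)
        ; glueʳ  = λ e → solve-glue g (glueʳ g (h⁻¹-side (y ⊕ m) e)) (inverseʳ (h∈L M _) _) } }
    where
    h⁻¹ : Z → Ω → Ω
    h⁻¹ y = inverse (h∈L M (σ⁻¹ M y))
    law⁻¹ : Law (rev M) (σ⁻¹ M)
    law⁻¹ = Law-inverse (rev M) (σ-σ⁻¹ M) (σ⁻¹-σ M) (law M)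
    h⁻¹-side : ∀ y {x} → blk x ≡ side y → blk (h⁻¹ y x) ≡ side (σ⁻¹ M y)
    -- A witness `z` in the source block has its image in the block of `x`, so the preimage of `x`
    -- lies in the block of `z`.
    h⁻¹-side y {x} e with inhabited (side (σ⁻¹ M y))
    ... | z , ez = trans
      (same-block (inverse∈L (h∈L M _)) (trans e (sym (trans (h-side M (σ⁻¹ M y) ez) (cong side (σ-σ⁻¹ M y))))))
      (trans (cong blk (inverseˡ (h∈L M (σ⁻¹ M y)) z)) ez)
    solve-glue : ∀ {y z x x′ x″} (g : Glued (h M) y z) → glue g x′ ≡ x″ → x″ ≡ x → inverse (glue∈L g) x ≡ x′
    solve-glue {x′ = x′} g e e′ = trans (cong (inverse (glue∈L g)) (sym (trans e e′))) (inverseˡ (glue∈L g) x′)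

  act-id : ∀ {n} (v : Path (suc n)) → act identity v ≡ v
  act-id v = act-unique identity v v λ t → onPoint≡ identity refl refl

  onPoint-compose : ∀ M N P → onPoint (compose M N) P ≡ onPoint M (onPoint N P)
  onPoint-compose M N P = onPoint≡ (compose M N) refl
    (sym (trans (coord-onPoint M (onPoint N P)) (cong (h M (σ N (proj₁ P))) (coord-onPoint N P))))

  act-compose : ∀ M N {n} (v : Path (suc n)) → act (compose M N) v ≡ act M (act N v)
  act-compose M N v = act-unique (compose M N) v (act M (act N v)) λ t → begin
    onPoint (compose M N) (at v t)                      ≡⟨ onPoint-compose M N (at v t) ⟩
    onPoint M (onPoint N (at v t))                      ≡⟨ cong (onPoint M) (at-act N v t) ⟨
    onPoint M (at (act N v) (flip (rev N) t))           ≡⟨ at-act M (act N v) _ ⟨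
    at (act M (act N v)) (flip (rev M) (flip (rev N) t)) ≡⟨ cong (at (act M (act N v))) (flip-xor (rev M) (rev N) t) ⟨
    at (act M (act N v)) (flip (rev M xor rev N) t)     ∎
    where open ≡-Reasoning

  onPoint-invertˡ : ∀ M P → onPoint (invert M) (onPoint M P) ≡ P
  onPoint-invertˡ M P = onPoint≡ (invert M) (σ⁻¹-σ M (proj₁ P))
    (trans (cong (h (invert M) (σ M (proj₁ P))) (coord-onPoint M P)) (cancel _ (σ⁻¹-σ M (proj₁ P))))
    where
    -- The layer `σ⁻¹ (σ y)` equals `y` only propositionally, and the inverse depends on it;
    -- generalising the layer allows matching on `refl`.
    cancel : ∀ y → y ≡ proj₁ P → inverse (h∈L M y) (h M (proj₁ P) (coord P)) ≡ coord P
    cancel _ refl = inverseˡ (h∈L M (proj₁ P)) (coord P)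

  onPoint-invertʳ : ∀ M P → onPoint M (onPoint (invert M) P) ≡ P
  onPoint-invertʳ M P = onPoint≡ M (σ-σ⁻¹ M (proj₁ P))
    (trans (cong (h M _) (coord-onPoint (invert M) P)) (inverseʳ (h∈L M _) (coord P)))

  act-invertˡ : ∀ M {n} (v : Path (suc n)) → act (invert M) (act M v) ≡ v
  act-invertˡ M v = act-unique (invert M) (act M v) v λ t → begin
    onPoint (invert M) (at (act M v) t)
      ≡⟨ cong (onPoint (invert M) ∘ at (act M v)) (flip-flip (rev M) t) ⟨
    onPoint (invert M) (at (act M v) (flip (rev M) (flip (rev M) t)))
      ≡⟨ cong (onPoint (invert M)) (at-act M v _) ⟩
    onPoint (invert M) (onPoint M (at v (flip (rev M) t)))
      ≡⟨ onPoint-invertˡ M _ ⟩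
    at v (flip (rev M) t) ∎
    where open ≡-Reasoning

  act-invertʳ : ∀ M {n} (v : Path (suc n)) → act M (act (invert M) v) ≡ v
  act-invertʳ M v = act-unique M (act (invert M) v) v λ t → begin
    onPoint M (at (act (invert M) v) t)
      ≡⟨ cong (onPoint M ∘ at (act (invert M) v)) (flip-flip (rev M) t) ⟨
    onPoint M (at (act (invert M) v) (flip (rev M) (flip (rev M) t)))
      ≡⟨ cong (onPoint M) (at-act (invert M) v _) ⟩
    onPoint M (onPoint (invert M) (at v (flip (rev M) t)))
      ≡⟨ onPoint-invertʳ M _ ⟩
    at v (flip (rev M) t) ∎
    where open ≡-Reasoning

  X : Set
  X = CVertex k r s

  Adj : X → X → Set
  Adj = CAdj k r s

  -- Motions whose labels differ only off their blocks induce the same permutation, so membership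
  -- asks for some motion inducing `g`.
  G : (X → X) → Set
  G g = Σ Motion λ M → ∀ v → g v ≡ act M v

  G-isPermGroup : IsPermGroup G
  G-isPermGroup = record
    { ext    = λ f g f≗g (M , e) → M , λ v → trans (sym (f≗g v)) (e v)
    ; has-id = identity , λ v → sym (act-id v)
    ; comp   = λ f g (M , e) (N , e′) → compose M N , λ v →
        trans (e (g v)) (trans (cong (act M) (e′ v)) (sym (act-compose M N v)))
    ; inv    = λ f (M , e) → act (invert M) , (invert M , λ _ → refl)
        , (λ v → trans (cong (act (invert M)) (e v)) (act-invertˡ M v))
        , (λ v → trans (e _) (act-invertʳ M v))
    }

  -- Edges as paths with `m` points, and arcs.

  emb : ∀ {n} → Bool → Fin n → Fin (suc n)
  emb false = inject₁
  emb true  = suc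

  -- An edge of C(k,r,s) is a path with m = s + 1 points; false drops its last point, true its first.
  end : ∀ {n} → Bool → Path (suc n) → Path n
  end false (i , W) = i , tabulate (lookup W ∘ inject₁)
  end true  (i , W) = i ⊕ 1 , tail W

  at-end : ∀ {n} d (Y : Path (suc n)) t → at (end d Y) t ≡ at Y (emb d t)
  at-end false (i , W)     t = cong₂ _,_ (cong (i ⊕_) (sym (toℕ-inject₁ t))) (lookup∘tabulate _ t)
  at-end true  (i , _ ∷ _) t = cong (_, _) (⊕-⊕ i 1 (toℕ t))

  flip-emb : ∀ ε d {n} (t : Fin n) → flip ε (emb d t) ≡ emb (ε xor d) (flip ε t)
  flip-emb false d     t = refl
  flip-emb true  false t = opposite-inject₁ t
  flip-emb true  true  t = refl

  -- Reversal exchanges dropping the first point with dropping the last. Questions about arcs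
  -- thereby become questions about one path with `m` points.
  act-end : ∀ M d {n} (Y : Path (suc (suc n))) → act M (end d Y) ≡ end (rev M xor d) (act M Y)
  act-end M d Y = act-unique M (end d Y) (end (rev M xor d) (act M Y)) λ t → begin
    onPoint M (at (end d Y) t)                     ≡⟨ cong (onPoint M) (at-end d Y t) ⟩
    onPoint M (at Y (emb d t))                     ≡⟨ at-act M Y _ ⟨
    at (act M Y) (flip (rev M) (emb d t))          ≡⟨ cong (at (act M Y)) (flip-emb (rev M) d t) ⟩
    at (act M Y) (emb (rev M xor d) (flip (rev M) t)) ≡⟨ at-end (rev M xor d) (act M Y) _ ⟨
    at (end (rev M xor d) (act M Y)) (flip (rev M) t) ∎
    where open ≡-Reasoning

  -- The orientation is a Boolean so that a motion acts on it by `rev M xor_`, which the two-case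
  -- form of `Adj` does not offer directly.
  record Arc (u v : X) : Set where
    constructor arc
    field
      edge : Path m
      dir  : Bool
      tail≡ : end dir edge ≡ u
      head≡ : end (not dir) edge ≡ v

  Extends⇒ : ∀ (u v : X) → Extends u v → Σ (Path m) λ Y → end false Y ≡ u × end true Y ≡ v
  -- The union of the two paths is the first point of `u` followed by `v`.
  Extends⇒ (i , w) (j , w′) (i→j , agree) = (i , head w ∷ w′)
    , cong (i ,_) (trans (tabulate-cong (same w w′ agree)) (tabulate∘lookup w))
    , cong (_, w′) (sym (NextLayer⇒⊕1 i→j))
    where
    same : ∀ {n} (w w′ : Vec (Fin k) (suc n)) →
      (∀ t t′ → toℕ t′ ≡ suc (toℕ t) → lookup w′ t ≡ lookup w t′) →
      ∀ t → lookup (head w ∷ w′) (inject₁ t) ≡ lookup w t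
    same (x ∷ w) w′ o zero    = refl
    same w       w′ o (suc t) = o (inject₁ t) (suc t) (cong suc (sym (toℕ-inject₁ t)))

  Extends-end : ∀ (Y : Path m) → Extends (end false Y) (end true Y)
  Extends-end (i , W@(_ ∷ _)) = NextLayer-⊕1 i , λ t t′ e →
    trans (cong (lookup W) (toℕ-injective (trans (sym e) (sym (toℕ-inject₁ t′)))))
          (sym (lookup∘tabulate (lookup W ∘ inject₁) t′))

  Adj⇒Arc : ∀ u v → Adj u v → Arc u v
  Adj⇒Arc u v (inj₁ e) = let Y , p , q = Extends⇒ u v e in arc Y false p q
  Adj⇒Arc u v (inj₂ e) = let Y , p , q = Extends⇒ v u e in arc Y true q p

  Arc⇒Adj : ∀ {u v} → Arc u v → Adj u v
  Arc⇒Adj (arc Y false refl refl) = inj₁ (Extends-end Y)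
  Arc⇒Adj (arc Y true  refl refl) = inj₂ (Extends-end Y)

  act-Arc : ∀ M {u v} → Arc u v → Arc (act M u) (act M v)
  act-Arc M (arc Y d p q) = arc (act M Y) (rev M xor d)
    (trans (sym (act-end M d Y)) (cong (act M) p))
    (trans (trans (cong (λ δ → end δ (act M Y)) (not-distribʳ-xor (rev M) d)) (sym (act-end M (not d) Y)))
           (cong (act M) q))

  G-isAutGroup : IsAutGroup Adj G
  G-isAutGroup g (M , e) u v =
    (λ a → subst₂ Adj (sym (e u)) (sym (e v)) (Arc⇒Adj (act-Arc M (Adj⇒Arc u v a)))) ,
    (λ a → subst₂ Adj (undo u) (undo v) (Arc⇒Adj (act-Arc (invert M) (Adj⇒Arc (g u) (g v) a))))
    where
    undo : ∀ x → act (invert M) (g x) ≡ x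
    undo x = trans (cong (act (invert M)) (e x)) (act-invertˡ M x)

  -- Labels constant on the residue classes of layers mod m, up to elements μ y acting trivially
  -- on the layers y ± m; they send the path Y to Y′ as soon as they do so class by class.
  module Build
    (ε : Bool) (Y Y′ : Path m) (H : Fin m → Ω → Ω) (H∈L : ∀ t → L (H t))
    (H-sends : ∀ t → H t (coord (at Y t)) ≡ coord (at Y′ (flip ε t)))
    (μ : Z → Ω → Ω) (μ-Fix : ∀ y → Fix (not (side y)) (μ y)) where

    j : Z
    j = proj₁ Y

    base : Bool → Z
    base false = proj₁ Y′
    -- A reflection takes the first layer of `Y` to the last layer of `Y′`, which is `s = m - 1`
    -- steps after its first.
    base true  = proj₁ Y′ ⊕ s

    τ : Z → Z
    τ = turn ε j (base ε)

    τ-law : Law ε τ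
    τ-law = Law-turn ε j (base ε)

    τ-start : ∀ ε′ → turn ε′ j (base ε′) j ≡ base ε′
    τ-start ε′ = turn-base ε′ j (base ε′)

    τ-layer : ∀ ε′ (t : Fin m) → turn ε′ j (base ε′) (j ⊕ toℕ t) ≡ proj₁ Y′ ⊕ toℕ (flip ε′ t)
    τ-layer false t = trans (Law-turn false j (base false) j _) (cong (_⊕ toℕ t) (τ-start false))
    τ-layer true  t = ⊕-cancelʳ (toℕ t) (trans (Law-turn true j (base true) j _) (trans (τ-start true)
      (sym (trans (⊕-⊕ _ _ _) (cong (proj₁ Y′ ⊕_) (trans (+-comm (toℕ (opposite t)) _) (toℕ-opposite-+ t)))))))

    label : Z → Ω → Ω
    label y = H (cls j y) ∘ μ y

    -- On a layer of `Y` the point prescribed by `H-sends` decides the block. A step of `m` keeps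
    -- the class, hence `H`, and flips the sides of both `y` and `τ y`.
    H-side : ∀ y {x} → blk x ≡ side y → blk (H (cls j y) x) ≡ side (τ y)
    H-side = layer-induction (λ y → ∀ {x} → blk x ≡ side y → blk (H (cls j y) x) ≡ side (τ y)) j
      (λ t {x} e → subst (λ c → blk (H c x) ≡ side (τ (j ⊕ toℕ t))) (sym (cls-toℕ j t))
        (trans (same-block (H∈L t) (trans e (sym (blk-coord (at Y t)))))
        (trans (cong blk (H-sends t)) (trans (blk-coord (at Y′ (flip ε t))) (cong side (sym (τ-layer ε t)))))))
      step
      where
      side-τ : ∀ ε′ {τ′} → Law ε′ τ′ → ∀ y → side (τ′ (y ⊕ m)) ≡ not (side (τ′ y))
      side-τ false p y = trans (cong side (p y m)) (side-⊕m _)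
      side-τ true  p y = trans (sym (not-involutive _)) (cong not (trans (sym (side-⊕m _)) (cong side (p y m))))
      step : ∀ y → (∀ {x} → blk x ≡ side y → blk (H (cls j y) x) ≡ side (τ y)) →
             ∀ {x} → blk x ≡ side (y ⊕ m) → blk (H (cls j (y ⊕ m)) x) ≡ side (τ (y ⊕ m))
      step y ih {x} e with inhabited (side y)
      ... | z , ez = subst (λ c → blk (H c x) ≡ side (τ (y ⊕ m))) (sym (cls-⊕m j y))
        (trans (other-block (H∈L _) (trans e (trans (side-⊕m y) (cong not (sym ez)))))
        (trans (cong not (ih ez)) (sym (side-τ ε τ-law y))))

    motion : Motion
    motion = record
      { rev = ε ; σ = τ ; σ⁻¹ = turn ε (base ε) j
      ; σ-σ⁻¹ = turn-inverse ε (base ε) j ; σ⁻¹-σ = turn-inverse ε j (base ε) ; law = τ-law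
      ; h = label ; h∈L = λ y → comp _ _ (H∈L _) (proj₁ (μ-Fix y))
      ; h-side = λ y e → H-side y (trans (Fix-preserves (μ-Fix y) _) e)
      ; glued = λ y → record
        -- On the block of `y` the factor `μ (y ⊕ m)` is trivial; on the other block it preserves
        -- the block, and there `μ y` is trivial.
        { glue   = H (cls j y) ∘ μ y ∘ μ (y ⊕ m)
        ; glue∈L = comp _ _ (H∈L _) (comp _ _ (proj₁ (μ-Fix y)) (proj₁ (μ-Fix (y ⊕ m))))
        ; glueˡ  = λ {x} e → cong (H (cls j y) ∘ μ y) (proj₂ (μ-Fix (y ⊕ m)) x
            (trans e (sym (trans (cong not (side-⊕m y)) (not-involutive _)))))
        ; glueʳ  = λ {x} e → trans
            (cong (H (cls j y)) (proj₂ (μ-Fix y) _ (trans (Fix-preserves (μ-Fix (y ⊕ m)) x) (trans e (side-⊕m y)))))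
            (cong (λ c → H c (μ (y ⊕ m) x)) (sym (cls-⊕m j y))) } }

    act-motion : (∀ t → μ (j ⊕ toℕ t) (coord (at Y t)) ≡ coord (at Y t)) → act motion Y ≡ Y′
    act-motion fixed = act-unique motion Y Y′ λ t → onPoint≡ motion (τ-layer ε t)
      (trans (cong (H (cls j (j ⊕ toℕ t))) (fixed t))
      (trans (cong (λ c → H c (coord (at Y t))) (cls-toℕ j t)) (H-sends t)))

  -- Arc-transitivity and the local action.

  module Transitivity (L-trans : Transitive L) where

    arc-transitive : ArcTransitive Adj G
    arc-transitive u v u′ v′ a a′ with Adj⇒Arc u v a | Adj⇒Arc u′ v′ a′
    ... | arc Y d p q | arc Y′ d′ p′ q′ = act B.motion , (B.motion , λ _ → refl)
      , trans (cong (act B.motion) (sym p)) (trans (act-end B.motion d Y)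
          (trans (cong₂ end (xor-xor d′ d) sends) p′))
      , trans (cong (act B.motion) (sym q)) (trans (act-end B.motion (not d) Y)
          (trans (cong₂ end (trans (sym (not-distribʳ-xor (d′ xor d) d)) (cong not (xor-xor d′ d))) sends) q′))
      where
      choice : ∀ t → _
      choice t = L-trans (coord (at Y t)) (coord (at Y′ (flip (d′ xor d) t)))
      -- The motion reverses exactly when the two orientations differ; all twists are taken trivial.
      module B = Build (d′ xor d) Y Y′ (proj₁ ∘ choice) (proj₁ ∘ proj₂ ∘ choice) (proj₂ ∘ proj₂ ∘ choice)
                       (λ _ → id) (λ y → Fix-id _)
      sends : act B.motion Y ≡ Y′
      sends = B.act-motion λ _ → refl

    -- The shift that undoes `⊕ 1`, so the preceding layer is reached by going forward around the
    -- cycle.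
    prev : Z → Z
    prev y = y ⊕ diff (y ⊕ 1) y

    prev-⊕1 : ∀ y → prev y ⊕ 1 ≡ y
    prev-⊕1 y = trans (⊕-swap y _ 1) (⊕-diff (y ⊕ 1) y)

    extend : Bool → X → Fin k → Path m
    extend false (i , w) x = i , w ∷ʳ x
    extend true  (i , w) x = prev i , x ∷ w

    end-extend : ∀ δ v x → end δ (extend δ v x) ≡ v
    end-extend false (i , w) x = cong (i ,_)
      (lookup-injective λ t → trans (lookup∘tabulate (lookup (w ∷ʳ x) ∘ inject₁) t) (lookup-∷ʳ-inject₁ w x t))
    end-extend true  (i , w) x = cong (_, w) (prev-⊕1 i)

    -- The position that `end δ` drops and `extend δ` fills.
    tip : Bool → Fin m
    tip false = fromℕ s
    tip true  = zero

    flip-tip : ∀ ε δ → flip ε (tip δ) ≡ tip (ε xor δ)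
    flip-tip false δ     = refl
    flip-tip true  false = opposite-involutive zero
    flip-tip true  true  = refl

    extend-end : ∀ δ Y → extend δ (end δ Y) (proj₂ (at Y (tip δ))) ≡ Y
    extend-end false (i , W) = cong (i ,_) (lookup-injective pointwise)
      where
      W₀ : Vec (Fin k) s
      W₀ = tabulate (lookup W ∘ inject₁)
      pointwise : lookup (W₀ ∷ʳ lookup W (fromℕ s)) ≗ lookup W
      pointwise t with view t
      ... | ‵fromℕ      = lookup-∷ʳ-fromℕ W₀ _
      ... | ‵inject₁ t′ = trans (lookup-∷ʳ-inject₁ W₀ _ t′) (lookup∘tabulate (lookup W ∘ inject₁) t′)
    extend-end true (i , x ∷ w) = cong (_, x ∷ w) (⊕-cancelʳ 1 (prev-⊕1 (i ⊕ 1)))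

    tipLayer : Bool → X → Z
    tipLayer false (i , _) = i ⊕ s
    tipLayer true  (i , _) = prev i

    -- The `m - 1` layers of `v` lie strictly between the two outer ones. Hence the field `glued`
    -- applies to exactly the layers that determine the neighbours of `v`.
    prev-⊕m : ∀ v → tipLayer true v ⊕ m ≡ tipLayer false v
    prev-⊕m (i , w) = trans (sym (⊕-⊕ (prev i) 1 s)) (cong (_⊕ s) (prev-⊕1 i))

    at-tip : ∀ δ v x → at (extend δ v x) (tip δ) ≡ (tipLayer δ v , x)
    at-tip false (i , w) x = cong₂ _,_ (cong (i ⊕_) (toℕ-fromℕ s)) (lookup-∷ʳ-fromℕ w x)
    at-tip true  (i , w) x = cong (_, x) (⊕-0 (prev i))

    frontSide : X → Bool
    frontSide v = side (tipLayer false v)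

    side-tip : ∀ δ v → side (tipLayer δ v) ≡ δ xor frontSide v
    side-tip false v = refl
    side-tip true  v = trans (sym (not-involutive _)) (cong not (trans (sym (side-⊕m _)) (cong side (prev-⊕m v))))

    -- The neighbour of v labelled ω lies behind v (true) or ahead of v (false), according to
    -- which of the layers just outside v carries the block of ω.
    dirOf : X → Ω → Bool
    dirOf v ω = blk ω xor frontSide v

    side-dirOf : ∀ v ω → side (tipLayer (dirOf v ω) v) ≡ blk ω
    side-dirOf v ω = trans (side-tip (dirOf v ω) v) (xor-xor (blk ω) (frontSide v))

    neighbour : X → Ω → X
    neighbour v ω = end (not (dirOf v ω)) (extend (dirOf v ω) v (ψ ω))

    neighbour≡ : ∀ v {ω δ x} → dirOf v ω ≡ δ → ψ ω ≡ x → neighbour v ω ≡ end (not δ) (extend δ v x)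
    neighbour≡ v refl refl = refl

    -- The edge from `v` to the neighbour goes to another edge extending `v`, on the other side if
    -- `M` reverses; only its tip has to be followed, and the tip moves by the label of its layer.
    act-neighbour : ∀ M v → act M v ≡ v → ∀ ω →
      act M (neighbour v ω) ≡ neighbour v (h M (tipLayer (dirOf v ω) v) ω)
    act-neighbour M v fixed ω = begin
      act M (end (not δ) Y)                    ≡⟨ act-end M (not δ) Y ⟩
      end (rev M xor not δ) (act M Y)          ≡⟨ cong₂ end (sym (not-distribʳ-xor (rev M) δ)) Y₁≡ ⟩
      end (not δ′) (extend δ′ v (ψ ω′))        ≡⟨ neighbour≡ v dir≡ refl ⟨
      neighbour v ω′                           ∎
      where
      open ≡-Reasoning
      δ δ′ : Bool
      δ  = dirOf v ω
      δ′ = rev M xor δ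
      Y : Path m
      Y = extend δ v (ψ ω)
      y : Z
      y = tipLayer δ v
      ω′ : Ω
      ω′ = h M y ω
      blk≡ : blk ω ≡ side y
      blk≡ = sym (side-dirOf v ω)
      tip≡ : at (act M Y) (tip δ′) ≡ (σ M y , ψ ω′)
      tip≡ = begin
        at (act M Y) (tip δ′)              ≡⟨ cong (at (act M Y)) (flip-tip (rev M) δ) ⟨
        at (act M Y) (flip (rev M) (tip δ)) ≡⟨ at-act M Y (tip δ) ⟩
        onPoint M (at Y (tip δ))           ≡⟨ cong (onPoint M) (at-tip δ v (ψ ω)) ⟩
        onPoint M (y , ψ ω)                ≡⟨ cong (λ z → σ M y , ψ (h M y z)) (φ-ψ′ blk≡) ⟩
        (σ M y , ψ ω′)                     ∎
      end≡ : end δ′ (act M Y) ≡ v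
      end≡ = trans (sym (act-end M δ Y)) (trans (cong (act M) (end-extend δ v (ψ ω))) fixed)
      Y₁≡ : act M Y ≡ extend δ′ v (ψ ω′)
      Y₁≡ = trans (sym (extend-end δ′ (act M Y))) (cong₂ (extend δ′) end≡ (cong proj₂ tip≡))
      σy≡ : σ M y ≡ tipLayer δ′ v
      σy≡ = cong proj₁ (trans (sym tip≡) (trans (cong (λ W → at W (tip δ′)) Y₁≡) (at-tip δ′ v (ψ ω′))))
      dir≡ : dirOf v ω′ ≡ δ′
      dir≡ = trans (cong (_xor frontSide v) (trans (h-side M y blk≡) (trans (cong side σy≡) (side-tip δ′ v))))
                   (xor-xor δ′ (frontSide v))

    -- Equality would give `i ⊕ 2 ≡ i`, against `2 < r`. This separates the neighbours ahead of a
    -- vertex from those behind it.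
    ⊕1≢prev : ∀ {i} → i ⊕ 1 ≢ prev i
    ⊕1≢prev {i} e with ⊕-fixed 2<r (trans (sym (⊕-⊕ i 1 1)) (trans (cong (_⊕ 1) e) (prev-⊕1 i)))
    ... | ()

    end-extend-injective : ∀ v δ {x} δ′ {x′} → end (not δ) (extend δ v x) ≡ end (not δ′) (extend δ′ v x′) →
      δ ≡ δ′ × x ≡ x′
    end-extend-injective v@(i , y ∷ w) false false e = refl , ∷ʳ-injectiveʳ w w (cong proj₂ e)
    end-extend-injective v             true  true  e = refl , cong (head ∘ proj₂) e
    end-extend-injective v             false true  e = contradiction (cong proj₁ e) ⊕1≢prev
    end-extend-injective v             true  false e = contradiction (sym (cong proj₁ e)) ⊕1≢prev

    local-action : ∀ v → LocalActionIso Adj G L v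
    local-action v = record
      { nbr = neighbour v
      ; nbr-adj = λ ω → Arc⇒Adj (arc (extend (dirOf v ω) v (ψ ω)) (dirOf v ω) (end-extend _ v (ψ ω)) refl)
      ; nbr-inj = inj
      ; nbr-surj = surj
      ; induced∈L = λ g (M , e) gv≡v → induced M (trans (sym (e v)) gv≡v) g e
      ; L⊆induced = realise
      }
      where
      inj : ∀ ω ω′ → neighbour v ω ≡ neighbour v ω′ → ω ≡ ω′
      inj ω ω′ e with end-extend-injective v (dirOf v ω) (dirOf v ω′) e
      ... | dir≡ , ψ≡ = trans (sym (φ-ψ ω)) (trans (cong₂ φ (xor-cancelʳ (frontSide v) dir≡) ψ≡) (φ-ψ ω′))

      surj : ∀ w → Adj v w → Σ Ω λ ω → neighbour v ω ≡ w
      surj w a with Adj⇒Arc v w a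
      -- The label is the tip of the edge, placed in the block for which `dirOf` returns `δ`.
      ... | arc Y δ refl refl = φ (δ xor frontSide v) (proj₂ (at Y (tip δ)))
        , trans (neighbour≡ v (trans (cong (_xor frontSide v) (blk-φ _ _)) (xor-xor δ (frontSide v))) (ψ-φ _ _))
                (cong (end (not δ)) (extend-end δ Y))

      induced : ∀ M → act M v ≡ v → ∀ g → (∀ u → g u ≡ act M u) →
                Σ (Ω → Ω) λ f → L f × (∀ ω → g (neighbour v ω) ≡ neighbour v (f ω))
      -- The labels on the two layers just outside `v` are restrictions of the single element
      -- `glue Γ` of `L`.
      induced M fixed g e = glue Γ , glue∈L Γ , λ ω →
        trans (e _) (trans (act-neighbour M v fixed ω)
          (cong (neighbour v) (sym (agree (dirOf v ω) (sym (side-dirOf v ω))))))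
        where
        Γ : Glued (h M) (tipLayer true v) (tipLayer false v)
        Γ = subst (Glued (h M) _) (prev-⊕m v) (glued M (tipLayer true v))
        agree : ∀ δ {ω} → blk ω ≡ side (tipLayer δ v) → glue Γ ω ≡ h M (tipLayer δ v) ω
        agree false = glueʳ Γ
        agree true  = glueˡ Γ

      realise : ∀ f → L f → Σ (X → X) λ g → G g × g v ≡ v × (∀ ω → g (neighbour v ω) ≡ neighbour v (f ω))
      realise f Lf = act B.motion , (B.motion , λ _ → refl) , fixed
        , λ ω → trans (act-neighbour B.motion v fixed ω)
            (cong (λ c → neighbour v (H c ω)) (cls-tip (dirOf v ω)))
        where
        -- `ω₀` labels a neighbour behind `v`. If `f` sends it ahead, then `δ` is false and the
        -- motion has to reverse, whence `δ xor true` below.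
        ω₀ : Ω
        ω₀ = proj₁ (inhabited (side (tipLayer true v)))
        δ : Bool
        δ = dirOf v (f ω₀)
        Y Y′ : Path m
        Y  = extend true v (ψ ω₀)
        Y′ = extend δ v (ψ (f ω₀))
        choice : ∀ (t : Fin s) → Σ (Ω → Ω) λ g →
          L g × g (coord (at Y (suc t))) ≡ coord (at Y′ (flip (δ xor true) (suc t)))
        choice t = L-trans _ _
        H : Fin m → Ω → Ω
        -- Class zero contains both layers just outside `v`, so `f` acts on all neighbours. The
        -- other classes meet `v` and only have to carry its points to their places.
        H zero    = f
        H (suc t) = proj₁ (choice t)
        H∈L : ∀ t → L (H t)
        H∈L zero    = Lf
        H∈L (suc t) = proj₁ (proj₂ (choice t))
        tip≡ : at Y′ (flip (δ xor true) zero) ≡ (tipLayer δ v , ψ (f ω₀))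
        tip≡ = trans (cong (at Y′) (trans (flip-tip (δ xor true) true) (cong tip (xor-xor δ true)))) (at-tip δ v _)
        H-sends : ∀ t → H t (coord (at Y t)) ≡ coord (at Y′ (flip (δ xor true) t))
        H-sends (suc t) = proj₂ (proj₂ (choice t))
        H-sends zero    = trans
          (cong f (trans (cong coord (at-tip true v (ψ ω₀))) (φ-ψ′ (proj₂ (inhabited (side (tipLayer true v)))))))
          (sym (trans (cong coord tip≡) (φ-ψ′ (sym (side-dirOf v (f ω₀))))))
        module B = Build (δ xor true) Y Y′ H H∈L H-sends (λ _ → id) (λ y → Fix-id _)
        fixed : act B.motion v ≡ v
        fixed = trans (cong (act B.motion) (sym (end-extend true v (ψ ω₀))))
          (trans (act-end B.motion true Y)
          (trans (cong₂ end (xor-xor δ true) (B.act-motion λ _ → refl)) (end-extend δ v _)))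
        cls-prev : cls (tipLayer true v) (tipLayer true v) ≡ zero
        cls-prev = trans (cong (cls (tipLayer true v)) (sym (⊕-0 _))) (cls-toℕ (tipLayer true v) zero)
        cls-tip : ∀ δ′ → cls (tipLayer true v) (tipLayer δ′ v) ≡ zero
        cls-tip true  = cls-prev
        cls-tip false = trans (cong (cls (tipLayer true v)) (sym (prev-⊕m v)))
          (trans (cls-⊕m (tipLayer true v) (tipLayer true v)) cls-prev)

    locallyL : LocallyL Adj G L
    locallyL = arc-transitive , local-action

  -- The order of an arc-stabiliser.

  module ArcStabiliser
    {a b : ℕ} (card-Fix : ∀ β → HasCard (Fix β) a) (card-Stab : ∀ ω → HasCard (Stab L ω) b)
    (N : ℕ) (r≡ : r ≡ m + (m + N)) (Y : Path m) where

    open HasCard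

    i : Z
    i = proj₁ Y

    q : Fin m → Ω
    q t = coord (at Y t)

    blk-q : ∀ t → blk (q t) ≡ side (i ⊕ toℕ t)
    blk-q t = blk-coord (at Y t)

    -- Every layer is exactly one of i ⊕ t, i ⊕ (m + t) and i ⊕ (m + (m + e)) for t < m and e < N.
    Slot : Set
    Slot = Fin m ⊎ Fin m ⊎ Fin N

    index : Slot → Fin (m + (m + N))
    index p = join m (m + N) (map₂ (join m N) p)

    layer : Slot → Z
    layer p = i ⊕ toℕ (index p)

    slot : Z → Slot
    slot y = map₂ (splitAt m) (splitAt m (cast r≡ (fromℕ< (off<r i y))))

    slot-index : ∀ p → map₂ (splitAt m) (splitAt m (index p)) ≡ p
    slot-index (inj₁ t) = cong (map₂ (splitAt m)) (splitAt-join m (m + N) (inj₁ t))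
    slot-index (inj₂ p) = trans (cong (map₂ (splitAt m)) (splitAt-join m (m + N) (inj₂ (join m N p))))
                                (cong inj₂ (splitAt-join m N p))

    index-slot : ∀ n → index (map₂ (splitAt m) (splitAt m n)) ≡ n
    index-slot n = trans (lemma (splitAt m n)) (join-splitAt m (m + N) n)
      where
      lemma : ∀ p → index (map₂ (splitAt m) p) ≡ join m (m + N) p
      lemma (inj₁ t) = refl
      lemma (inj₂ p) = cong (λ x → join m (m + N) (inj₂ x)) (join-splitAt m N p)

    slot-layer : ∀ p → slot (layer p) ≡ p
    slot-layer p = trans (cong (map₂ (splitAt m) ∘ splitAt m) (toℕ-injective (begin
      toℕ (cast r≡ (fromℕ< (off<r i (layer p))))   ≡⟨ toℕ-cast r≡ _ ⟩
      toℕ (fromℕ< (off<r i (layer p)))             ≡⟨ toℕ-fromℕ< _ ⟩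
      off i (layer p)                              ≡⟨ off-⊕ i _ ⟩
      toℕ (index p) % r                            ≡⟨ m<n⇒m%n≡m (subst (toℕ (index p) <_) (sym r≡) (toℕ<n (index p))) ⟩
      toℕ (index p)                                ∎))) (slot-index p)
      where open ≡-Reasoning

    layer-slot : ∀ y → layer (slot y) ≡ y
    layer-slot y = trans (cong (i ⊕_) (begin
      toℕ (index (slot y))                  ≡⟨ cong toℕ (index-slot _) ⟩
      toℕ (cast r≡ (fromℕ< (off<r i y)))    ≡⟨ toℕ-cast r≡ _ ⟩
      toℕ (fromℕ< (off<r i y))              ≡⟨ toℕ-fromℕ< _ ⟩
      off i y                               ∎)) (⊕-off i y)
      where open ≡-Reasoning

    layer₀ : ∀ t → layer (inj₁ t) ≡ i ⊕ toℕ t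
    layer₀ t = cong (i ⊕_) (toℕ-↑ˡ t (m + N))

    layer₁ : ∀ t → layer (inj₂ (inj₁ t)) ≡ i ⊕ toℕ t ⊕ m
    layer₁ t = trans (cong (i ⊕_) (trans (toℕ-↑ʳ m (join m N (inj₁ t)))
                       (trans (cong (m +_) (toℕ-↑ˡ t N)) (+-comm m (toℕ t)))))
                     (sym (⊕-⊕ i (toℕ t) m))

    slot₀ : ∀ t → slot (i ⊕ toℕ t) ≡ inj₁ t
    slot₀ t = trans (cong slot (sym (layer₀ t))) (slot-layer (inj₁ t))

    slot₁ : ∀ t → slot (i ⊕ toℕ t ⊕ m) ≡ inj₂ (inj₁ t)
    slot₁ t = trans (cong slot (sym (layer₁ t))) (slot-layer (inj₂ (inj₁ t)))

    module _ (f : Fin N → Fin a) (g : Fin m → Fin b) where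

      -- The first `2m` layers stay untwisted: they contain two layers of opposite sides from each
      -- class, from which `H t` can be recovered on all of `Ω`.
      twist : Bool → Slot → Ω → Ω
      twist β (inj₁ _)        = id
      twist β (inj₂ (inj₁ _)) = id
      twist β (inj₂ (inj₂ e)) = elems (card-Fix β) (f e)

      twist-Fix : ∀ β p → Fix β (twist β p)
      twist-Fix β (inj₁ _)        = Fix-id β
      twist-Fix β (inj₂ (inj₁ _)) = Fix-id β
      twist-Fix β (inj₂ (inj₂ e)) = inP (card-Fix β) (f e)

      μ : Z → Ω → Ω
      μ y = twist (not (side y)) (slot y)

      H : Fin m → Ω → Ω
      H t = elems (card-Stab (q t)) (g t)

      H∈Stab : ∀ t → Stab L (q t) (H t)
      H∈Stab t = inP (card-Stab (q t)) (g t)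

      private module B = Build false Y Y H (proj₁ ∘ H∈Stab) (proj₂ ∘ H∈Stab) μ (λ y → twist-Fix _ (slot y))

      element : Motion
      element = B.motion

      element-fixes : act element Y ≡ Y
      element-fixes = B.act-motion λ t → cong (λ p → twist (not (side (i ⊕ toℕ t))) p (q t)) (slot₀ t)

      σ-element : ∀ y → σ element y ≡ y
      σ-element = Law-fixed (law element) (B.τ-start false)

      h₀ : ∀ t ω → h element (i ⊕ toℕ t) ω ≡ H t ω
      h₀ t ω = cong₂ (λ c p → H c (twist (not (side (i ⊕ toℕ t))) p ω)) (cls-toℕ i t) (slot₀ t)

      h₁ : ∀ t ω → h element (i ⊕ toℕ t ⊕ m) ω ≡ H t ω
      h₁ t ω = cong₂ (λ c p → H c (twist (not (side (i ⊕ toℕ t ⊕ m))) p ω))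
                       (trans (cls-⊕m i _) (cls-toℕ i t)) (slot₁ t)

      h₂ : ∀ e ω → let y = layer (inj₂ (inj₂ e)) in
           h element y ω ≡ H (cls i y) (elems (card-Fix (not (side y))) (f e) ω)
      h₂ e ω = cong (λ p → H (cls i y) (twist (not (side y)) p ω)) (slot-layer (inj₂ (inj₂ e)))
        where y = layer (inj₂ (inj₂ e))

    -- A constant path through a point witnesses the action on that point.
    onPoint-faithful : ∀ M M′ → rev M ≡ false → rev M′ ≡ false → (∀ (v : X) → act M v ≡ act M′ v) →
      ∀ P → onPoint M P ≡ onPoint M′ P
    onPoint-faithful M M′ r r′ e (y , x) = trans (sym (first M r)) (trans (cong (λ w → at w zero) (e v)) (first M′ r′))
      where
      v : X
      v = y , replicate s x
      first : ∀ M → rev M ≡ false → at (act M v) zero ≡ onPoint M (y , x)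
      first M r = trans (cong (λ ε → at (act M v) (flip ε zero)) (sym r))
        (trans (at-act M v zero) (cong (λ z → onPoint M (z , x)) (⊕-0 y)))

    onPoint⇒h : ∀ M M′ → (∀ P → onPoint M P ≡ onPoint M′ P) →
      ∀ y {ω} → blk ω ≡ side y → h M y ω ≡ h M′ y ω
    onPoint⇒h M M′ e y {ω} b = begin
      h M y ω                      ≡⟨ cong (h M y) (φ-ψ′ b) ⟨
      h M y (coord (y , ψ ω))      ≡⟨ coord-onPoint M _ ⟨
      coord (onPoint M (y , ψ ω))  ≡⟨ cong coord (e _) ⟩
      coord (onPoint M′ (y , ψ ω)) ≡⟨ coord-onPoint M′ _ ⟩
      h M′ y (coord (y , ψ ω))     ≡⟨ cong (h M′ y) (φ-ψ′ b) ⟩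
      h M′ y ω                     ∎
      where open ≡-Reasoning

    by-blocks : ∀ y {ℓ′} {P : Ω → Set ℓ′} → (∀ ω → blk ω ≡ side y → P ω) →
      (∀ ω → blk ω ≡ not (side y) → P ω) → ∀ ω → P ω
    by-blocks y p p′ ω with blk ω ≟ᵇ side y
    ... | yes e = p ω e
    ... | no ne = p′ ω (¬-not ne)

    -- Two untwisted layers at distance `m` recover `H t` on both blocks. On a later layer,
    -- cancelling `H` recovers the twist on the block of that layer, and on the other block every
    -- twist is the identity.
    element-injective : ∀ f g f′ g′ → (∀ (v : X) → act (element f g) v ≡ act (element f′ g′) v) →
      f ≗ f′ × g ≗ g′
    element-injective f g f′ g′ e = f≗ , g≗
      where
      E E′ : Motion
      E  = element f g
      E′ = element f′ g′
      h≡ : ∀ y {ω} → blk ω ≡ side y → h E y ω ≡ h E′ y ω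
      h≡ = onPoint⇒h E E′ (onPoint-faithful E E′ refl refl e)
      H≗ : ∀ t ω → H f g t ω ≡ H f′ g′ t ω
      H≗ t = by-blocks (i ⊕ toℕ t)
        (λ ω b → trans (sym (h₀ f g t ω)) (trans (h≡ _ b) (h₀ f′ g′ t ω)))
        (λ ω b → trans (sym (h₁ f g t ω)) (trans (h≡ _ (trans b (sym (side-⊕m _)))) (h₁ f′ g′ t ω)))
      g≗ : g ≗ g′
      g≗ t = distinct (card-Stab (q t)) _ _ (H≗ t)
      f≗ : f ≗ f′
      f≗ x = distinct F _ _ (by-blocks y
        (λ ω b → L-injective (proj₁ (H∈Stab f g (cls i y)))
          (trans (sym (h₂ f g x ω)) (trans (h≡ y b) (trans (h₂ f′ g′ x ω) (sym (H≗ (cls i y) _))))))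
        (λ ω b → trans (proj₂ (inP F (f x)) ω b) (sym (proj₂ (inP F (f′ x)) ω b))))
        where
        y = layer (inj₂ (inj₂ x))
        F = card-Fix (not (side y))

    module _ (M : Motion) (rot : rev M ≡ false) (fixed : act M Y ≡ Y) where

      onPoint-fixed : ∀ t → onPoint M (at Y t) ≡ at Y t
      onPoint-fixed t = trans (sym (at-act M Y t)) (cong₂ at fixed (cong (λ ε → flip ε t) rot))

      σ-fixed : ∀ y → σ M y ≡ y
      σ-fixed = Law-fixed (subst (λ ε → Law ε (σ M)) rot (law M)) (cong proj₁ (onPoint-fixed zero))

      -- The glue on the edge's layer and the next layer of its class fixes `q t`; these `m`
      -- stabiliser elements account for the factor `b ^ m`.
      Γ : ∀ (t : Fin m) → Glued (h M) (i ⊕ toℕ t) (i ⊕ toℕ t ⊕ m)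
      Γ t = glued M (i ⊕ toℕ t)

      Γ-fixes : ∀ t → glue (Γ t) (q t) ≡ q t
      Γ-fixes t = trans (glueˡ (Γ t) (blk-q t)) (trans (sym (coord-onPoint M (at Y t))) (cong coord (onPoint-fixed t)))

      -- Such a `ν` is determined up to `≗`: on the block of `y` by the equation, since `glue` is
      -- injective, and on the other block by being trivial.
      Twisted : Z → Set
      Twisted y = Σ (Ω → Ω) λ ν → Fix (not (side y)) ν ×
        (∀ {ω} → blk ω ≡ side y → h M y ω ≡ glue (Γ (cls i y)) (ν ω))

      -- Two elements of L that agree on the block of layer y differ by an element fixing that block.
      twisted-step : ∀ y → Twisted y → Twisted (y ⊕ m)
      twisted-step y (ν , ν-Fix , hν) = κ , κ-Fix′ , λ {ω} b →
        trans (sym (glueʳ Δ b)) (trans (sym (ΓνκΔ ω))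
          (trans (cong (glue (Γ (cls i y))) (proj₂ ν-Fix (κ ω) (trans (Fix-preserves κ-Fix ω) (trans b (side-⊕m y)))))
                 (cong (λ c → glue (Γ c) (κ ω)) (sym (cls-⊕m i y)))))
        where
        Δ : Glued (h M) y (y ⊕ m)
        Δ = glued M y
        Γν∈L : L (glue (Γ (cls i y)) ∘ ν)
        Γν∈L = comp (glue (Γ (cls i y))) ν (glue∈L (Γ (cls i y))) (proj₁ ν-Fix)
        κ : Ω → Ω
        κ = inverse Γν∈L ∘ glue Δ
        ΓνκΔ : ∀ ω → glue (Γ (cls i y)) (ν (κ ω)) ≡ glue Δ ω
        ΓνκΔ ω = inverseʳ Γν∈L (glue Δ ω)
        κ-Fix : Fix (side y) κ
        κ-Fix = comp (inverse Γν∈L) (glue Δ) (inverse∈L Γν∈L) (glue∈L Δ) , λ ω b →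
          trans (cong (inverse Γν∈L) (trans (glueˡ Δ b) (hν b))) (inverseˡ Γν∈L ω)
        κ-Fix′ : Fix (not (side (y ⊕ m))) κ
        κ-Fix′ = subst (λ β → Fix β κ) (sym (trans (cong not (side-⊕m y)) (not-involutive _))) κ-Fix

      twisted : ∀ y → Twisted y
      twisted = layer-induction Twisted i
        -- On a layer of the edge `Γ t` is glued to that layer's own label, so the twist there is
        -- `id`.
        (λ t → id , Fix-id _ , λ {ω} b → trans (sym (glueˡ (Γ t) b)) (cong (λ c → glue (Γ c) ω) (sym (cls-toℕ i t))))
        twisted-step

      stab-index : ∀ t → Σ (Fin b) λ n → glue (Γ t) ≗ elems (card-Stab (q t)) n
      stab-index t = complete (card-Stab (q t)) (glue (Γ t)) (glue∈L (Γ t) , Γ-fixes t)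

      fix-index : ∀ e → let y = layer (inj₂ (inj₂ e)) in
        Σ (Fin a) λ n → proj₁ (twisted y) ≗ elems (card-Fix (not (side y))) n
      fix-index e = complete (card-Fix _) _ (proj₁ (proj₂ (twisted (layer (inj₂ (inj₂ e))))))

      f̂ : Fin N → Fin a
      f̂ e = proj₁ (fix-index e)

      ĝ : Fin m → Fin b
      ĝ t = proj₁ (stab-index t)

      -- The functions decoded from an index agree with `f̂` and `ĝ` only pointwise.
      module _ {f : Fin N → Fin a} {g : Fin m → Fin b} (f≗ : f ≗ f̂) (g≗ : g ≗ ĝ) where

        E : Motion
        E = element f g

        glue≡H : ∀ t ω → glue (Γ t) ω ≡ H f g t ω
        glue≡H t ω = trans (proj₂ (stab-index t) ω) (cong (λ n → elems (card-Stab (q t)) n ω) (sym (g≗ t)))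

        h≡element : ∀ p {ω} → blk ω ≡ side (layer p) → h M (layer p) ω ≡ h E (layer p) ω
        h≡element (inj₁ t) {ω} = subst (λ y → blk ω ≡ side y → h M y ω ≡ h E y ω) (sym (layer₀ t))
          λ b → trans (sym (glueˡ (Γ t) b)) (trans (glue≡H t ω) (sym (h₀ f g t ω)))
        h≡element (inj₂ (inj₁ t)) {ω} = subst (λ y → blk ω ≡ side y → h M y ω ≡ h E y ω) (sym (layer₁ t))
          λ b → trans (sym (glueʳ (Γ t) b)) (trans (glue≡H t ω) (sym (h₁ f g t ω)))
        h≡element (inj₂ (inj₂ e)) {ω} b = trans (proj₂ (proj₂ (twisted y)) b)
          (trans (glue≡H (cls i y) (proj₁ (twisted y) ω))
          (trans (cong (H f g (cls i y)) (trans (proj₂ (fix-index e) ω)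
            (cong (λ n → elems (card-Fix (not (side y))) n ω) (sym (f≗ e))))) (sym (h₂ f g e ω))))
          where y = layer (inj₂ (inj₂ e))

        act≡element : ∀ (v : X) → act M v ≡ act E v
        act≡element v = act-unique M v (act E v) λ t → begin
          onPoint M (at v t)                   ≡⟨ onPoint≡element (at v t) ⟩
          onPoint E (at v t)                   ≡⟨ at-act E v t ⟨
          at (act E v) t                       ≡⟨ cong (λ ε → at (act E v) (flip ε t)) (sym rot) ⟩
          at (act E v) (flip (rev M) t)        ∎
          where
          open ≡-Reasoning
          onPoint≡element : ∀ P → onPoint M P ≡ onPoint E P
          onPoint≡element P = onPoint≡ M (trans (σ-fixed _) (sym (σ-element f g _)))
            (trans (subst (λ y → blk (coord P) ≡ side y → h M y (coord P) ≡ h E y (coord P))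
                          (layer-slot (proj₁ P)) (h≡element (slot (proj₁ P))) (blk-coord P))
                   (sym (coord-onPoint E P)))

    -- Exchanged ends would force `i ⊕ 2 ≡ i`. Thus a reversing motion cannot fix both ends of an
    -- edge.
    no-swap : ∀ (Y′ : Path m) → end true Y′ ≡ end false Y → ¬ (end false Y′ ≡ end true Y)
    no-swap Y′ e e′ with ⊕-fixed 2<r (trans (sym (⊕-⊕ i 1 1))
      (trans (cong (_⊕ 1) (sym (cong proj₁ e′))) (cong proj₁ e)))
    ... | ()

    end-injective : ∀ (Y′ : Path m) → end false Y′ ≡ end false Y → end true Y′ ≡ end true Y → Y′ ≡ Y
    end-injective Y′ e e′ = at-injective λ
      { zero    → trans (sym (at-end false Y′ zero)) (trans (cong (λ v → at v zero) e) (at-end false Y zero))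
      ; (suc t) → trans (sym (at-end true Y′ t)) (trans (cong (λ v → at v t) e′) (at-end true Y t)) }

    fixes-edge : ∀ M δ → act M (end δ Y) ≡ end δ Y → act M (end (not δ) Y) ≡ end (not δ) Y →
      rev M ≡ false × act M Y ≡ Y
    fixes-edge M δ e e′ =
      analyse (rev M) refl δ (trans (sym (act-end M δ Y)) e) (trans (sym (act-end M (not δ) Y)) e′)
      where
      analyse : ∀ ε → rev M ≡ ε → ∀ δ → end (ε xor δ) (act M Y) ≡ end δ Y →
        end (ε xor not δ) (act M Y) ≡ end (not δ) Y →
        rev M ≡ false × act M Y ≡ Y
      analyse false r false e e′ = r , end-injective (act M Y) e e′
      analyse false r true  e e′ = r , end-injective (act M Y) e′ e
      analyse true  r false e e′ = contradiction e′ (no-swap (act M Y) e)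
      analyse true  r true  e e′ = contradiction e (no-swap (act M Y) e′)

    arc-stabiliser-card : ∀ δ →
      HasCard (λ g → G g × g (end δ Y) ≡ end δ Y × g (end (not δ) Y) ≡ end (not δ) Y) (a ^ N * b ^ m)
    arc-stabiliser-card δ = record
      { elems    = λ n → act (el n)
      ; inP      = λ n → (el n , λ _ → refl) , fix n δ , fix n (not δ)
      ; distinct = λ n n′ e → let e₁ , e₂ = element-injective (fs n) (gs n) (fs n′) (gs n′) e in
          trans (sym (combine-remQuot {a ^ N} (b ^ m) n))
          (trans (cong₂ combine (finToFun-injective a N _ _ e₁) (finToFun-injective b m _ _ e₂))
                 (combine-remQuot {a ^ N} (b ^ m) n′))
      ; complete = comp′ }
      where
      fs : Fin (a ^ N * b ^ m) → Fin N → Fin a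
      fs n = finToFun (proj₁ (remQuot {a ^ N} (b ^ m) n))
      gs : Fin (a ^ N * b ^ m) → Fin m → Fin b
      gs n = finToFun (proj₂ (remQuot {a ^ N} (b ^ m) n))
      el : Fin (a ^ N * b ^ m) → Motion
      el n = element (fs n) (gs n)
      fix : ∀ n δ → act (el n) (end δ Y) ≡ end δ Y
      fix n δ = trans (act-end (el n) δ Y) (cong (end δ) (element-fixes (fs n) (gs n)))
      comp′ : ∀ g → G g × g (end δ Y) ≡ end δ Y × g (end (not δ) Y) ≡ end (not δ) Y →
              Σ (Fin (a ^ N * b ^ m)) λ n → g ≗ act (el n)
      comp′ g ((M , e) , p , p′) with fixes-edge M δ (trans (sym (e _)) p) (trans (sym (e _)) p′)
      ... | rot , fixed = n , λ v → trans (e v) (act≡element M rot fixed fs≗ gs≗ v)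
        where
        F = f̂ M rot fixed
        K = ĝ M rot fixed
        n : Fin (a ^ N * b ^ m)
        n = combine (funToFin F) (funToFin K)
        fs≗ : fs n ≗ F
        fs≗ x = trans (cong (λ z → finToFun (proj₁ z) x) (remQuot-combine (funToFin F) (funToFin K)))
                      (finToFun-funToFin F x)
        gs≗ : gs n ≗ K
        gs≗ x = trans (cong (λ z → finToFun (proj₂ z) x) (remQuot-combine (funToFin F) (funToFin K)))
                      (finToFun-funToFin K x)

theorem4p1 : (k : ℕ) (L : (Fin (2 * k) → Fin (2 * k)) → Set) →
    IsPermGroup L → (∀ f → Dec (L f)) → Transitive L →
    (blk : Fin (2 * k) → Bool) → IsTwoBlockSystem L blk →
    (ω : Fin (2 * k)) → (a b : ℕ) →
    HasCard (PointwiseStabA L blk) a → HasCard (Stab L ω) b →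
    (ℓ m : ℕ) → 1 ≤ ℓ → 2 ≤ m →
    (u v : CVertex k (2 * ℓ * m) (m ∸ 1)) → CAdj k (2 * ℓ * m) (m ∸ 1) u v →
    Σ ((CVertex k (2 * ℓ * m) (m ∸ 1) → CVertex k (2 * ℓ * m) (m ∸ 1)) → Set) λ G →
    IsPermGroup G × IsAutGroup (CAdj k (2 * ℓ * m) (m ∸ 1)) G ×
    LocallyL (CAdj k (2 * ℓ * m) (m ∸ 1)) G L ×
    HasCard (λ g → G g × g u ≡ u × g v ≡ v) (a ^ (2 * m * (ℓ ∸ 1)) * b ^ m)
theorem4p1 k L LG _ L-trans blk LB ω a b A-card ω-card (suc ℓ′) (suc (suc s′)) (s≤s z≤n) (s≤s (s≤s z≤n)) u v adj =
  G , G-isPermGroup , G-isAutGroup , locallyL L-trans , stabiliser u v (Adj⇒Arc u v adj)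
  where
  N : ℕ
  N = 2 * suc (suc s′) * ℓ′
  r≡ : 2 * suc ℓ′ * suc (suc s′) ≡ suc (suc s′) + (suc (suc s′) + N)
  -- The summands are the `m` layers of the edge, their shifts by `m`, and the `N` layers with a
  -- free twist.
  r≡ = solve 2 (λ x y → con 2 :* (con 1 :+ x) :* y := y :+ (y :+ con 2 :* y :* x)) refl ℓ′ (suc (suc s′))
    where open +-*-Solver
  2<r : 2 < 2 * suc ℓ′ * suc (suc s′)
  -- Here `r` is at least `2m`, hence at least 4.
  2<r = subst (2 <_) (sym r≡) (s≤s (s≤s (≤-trans (s≤s z≤n) (m≤n+m _ s′))))
  open Coordinates (coordinates k L LG L-trans blk LB)
  open Construction k L LG blk LB φ ψ blk-φ φ-ψ ψ-φ (suc ℓ′) s′ 2<r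
  open Transitivity using (locallyL)
  stabiliser : ∀ u v → Arc u v → HasCard (λ g → G g × g u ≡ u × g v ≡ v) (a ^ N * b ^ m)
  stabiliser _ _ (arc Y δ refl refl) = arc-stabiliser-card δ
    where open ArcStabiliser (HasCard-Fix L-trans A-card) (HasCard-Stab L-trans ω-card) N r≡ Y
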